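{- Let $m\ge n\ge 0$ be integers and let $\lambda$ be a partition inside an $n\times m$ board ($n$ rows, $m$ columns). For a column index $j$ let $\lambda^{[j]}$ denote $\lambda$ with column $j$ removed; for a row index $i$ let $\lambda_{[i]}$ denote $\lambda$ with row $i$ removed; and for a cell $(i,j)\in\lambda$ let $\lambda/(i,j)$ denote $\lambda$ with row $i$ and column $j$ removed. Consider the following three families of $q$-hit identities, indexed by $k$: $$\text{(H1)}\quad \sum_{i=1}^m q^{m+n-i-\lambda_i'}H_k^{m-1,n}(\lambda^{[i]})=[m-n]\,H_k^{m,n}(\lambda)\,q^{n-k},\qquad 0\le k\le n \quad(\text{for } m>n),$$ $$\text{(H2)}\quad [m-n+1]\sum_{i=m+1}^{m+n}q^{m+n-i-\lambda_i'}H_k^{m,n-1}(\lambda_{[m+n+1-i]})=H_k^{m,n}(\lambda)\,q^k[n-k]+H_{k+1}^{m,n}(\lambda)\,[k+1],\qquad 0\le k\le n-1\quad (\text{for } n\ge1),$$ $$\text{(H3)}\quad q^k\sum_{(i,j)\in\lambda}q^{i+(m-j-\lambda_j')}H_k^{m-1,n-1}(\lambda/(i,j))=[k+1]H_{k+1}^{m,n}(\lambda),\qquad 0\le k\le n-1\quad (\text{for } n\ge1).$$ These are equivalent, in that order (each family of identities in $k$ to the corresponding family), to the following $q$-rook identities: $$\text{(R1)}\quad \sum_{j=1}^m q^{m-j}R_k(\lambda^{[j]})=R_k(\lambda)[m-k]-R_{k+1}(\lambda)\,(q^m-q^{m-k-1}),\qquad 0\le k\le n,$$ $$\text{(R2)}\quad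 \sum_{i=1}^n q^{i-1+\lambda_i}R_k(\lambda_{[i]})=([n]-[k])R_k(\lambda),\qquad 0\le k\le n,$$ $$\text{(R3)}\quad \sum_{(i,j)\in\lambda}q^{i-j+\lambda_i}R_k(\lambda/(i,j))=q[k+1]R_{k+1}(\lambda),\qquad 0\le k\le n-1 .$$ That is, (H1) is equivalent to (R1), (H2) to (R2), and (H3) to (R3).
   Context: $q$-notation: $[x]=(1-q^x)/(1-q)$, $[a]_k=[a][a-1]\cdots[a-k+1]$, $[a]!=[a]_a$, and $(x;q)_k=\prod_{i=0}^{k-1}(1-xq^i)$; $q$ is an indeterminate. Boards and partitions: cell $(i,j)$ is in row $i$ from the top and column $j$ from the left. A partition $\lambda=(\lambda_1\ge\cdots\ge\lambda_n\ge 0)$ with $\lambda_1\le m$ is identified with the set of cells $(i,j)$ with $j\le\lambda_i$; $|\lambda|$ is its number of cells and $\lambda'_j$ is the number of cells in column $j$ (so $\lambda'_j=0$ for $j>\lambda_1$, in particular for $j>m$). Removing an empty row or column leaves the nonzero parts of $\lambda$ unchanged. $q$-rook numbers: $R_k(\lambda)=\sum_p q^{\mathrm{inv}(p)}$ over all placements $p$ of $k$ non-attacking rooks on cells of $\lambda$ (no two in the same row or column), where $\mathrm{inv}(p)$ is the number of cells of $\lambda$ left after each rook cancels its own cell, the cells North of it in its column, and the cells West of it in its row. $R_k(\lambda)=0$ if no such placement exists. $q$-hit numbers: for $\lambda$ inside an $n\times m$ board with $n\le m$, the $H_i^{m,n}(\lambda)$ are defined by $$\sum_{i=0}^n H_i^{m,n}(\lambda)x^i=\frac{q^{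 -|\lambda|}}{[m-n]!}\sum_{i=0}^n R_i(\lambda)\,[m-i]!\,(-1)^i q^{mi-\binom i2}(x;q)_i .$$ -}

module Defs where

open import Algebra.Apartness.Bundles using (HeytingCommutativeRing; HeytingField)
import Algebra.Apartness.Properties.HeytingCommutativeRing as HeytingProperties
open import Algebra.Bundles using (CommutativeRing)
import Algebra.Properties.Ring as RingProperties
import Algebra.Properties.Semiring.Exp as Exp
import Algebra.Properties.Semiring.Mult as Mult
open import Data.Integer.Base using (ℤ; +_; -[1+_]; 0ℤ; 1ℤ; -1ℤ)
  renaming (_+_ to _+ᶻ_; _-_ to _-ᶻ_; _*_ to _*ᶻ_; -_ to -ᶻ_)
open import Data.List.Base
  using (List; []; _∷_; _++_; map; concatMap; filter; foldr; length; take; drop;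
         replicate; upTo)
open import Data.List.Relation.Unary.All using (All)
open import Data.List.Relation.Unary.AllPairs using (allPairs?)
open import Data.List.Relation.Unary.Any using (Any; here; there; any?)
open import Data.List.Relation.Unary.Linked using (Linked)
open import Data.Nat.Base as ℕ using (ℕ; zero; suc; _∸_; _≤_; _<_; _≥_)
open import Data.Nat.Combinatorics using (_C_)
import Data.Nat.Properties as ℕₚ
open import Data.Product.Base using (_×_; _,_; proj₁; proj₂)
open import Data.Sum.Base using (_⊎_)
open import Level using (Level)
open import Relation.Binary.PropositionalEquality.Core using (_≡_; _≢_)
import Relation.Binary.Reasoning.Setoid as ≈-Reasoning
open import Relation.Nullary.Decidable using (Dec; yes; no; ¬?; _×-dec_; _⊎-dec_)

-- The range a, a + 1, …, b (empty when b < a).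
[_⋯_] : ℕ → ℕ → List ℕ
[ a ⋯ b ] = map (ℕ._+_ a) (upTo (suc b ∸ a))

-- A partition is the list of its parts, trailing zeros included, so that the
-- number of rows of the ambient board is the length of the list.  Rows and
-- columns are numbered from 1.

record InBoard (n m : ℕ) (μ : List ℕ) : Set where
  field
    rows       : length μ ≡ n
    decreasing : Linked _≥_ μ
    bounded    : All (_≤ m) μ

Cell : Set
Cell = ℕ × ℕ

part : List ℕ → ℕ → ℕ
part []       _             = 0
part (x ∷ μ) zero          = 0
part (x ∷ μ) (suc zero)    = x
part (x ∷ μ) (suc (suc i)) = part μ (suc i)

cells : List ℕ → List Cell
cells μ = concatMap (λ i → map (i ,_) [ 1 ⋯ part μ i ]) [ 1 ⋯ length μ ]

size : List ℕ → ℕ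
size μ = length (cells μ)

column : List ℕ → ℕ → ℕ
column μ j = length (filter (λ c → proj₂ c ℕₚ.≟ j) (cells μ))

removeRow : ℕ → List ℕ → List ℕ
removeRow i μ = take (i ∸ 1) μ ++ drop i μ

shorten : ℕ → ℕ → ℕ
shorten j r with j ℕₚ.≤? r
... | yes _ = r ∸ 1
... | no  _ = r

removeColumn : ℕ → List ℕ → List ℕ
removeColumn j = map (shorten j)

removeCell : Cell → List ℕ → List ℕ
removeCell (i , j) μ = removeColumn j (removeRow i μ)

-- The k-element subsets of a repetition-free list, each listed once.
subsets : {A : Set} → ℕ → List A → List (List A)
subsets zero    xs       = [] ∷ []
subsets (suc k) []       = []
subsets (suc k) (x ∷ xs) = map (x ∷_) (subsets k xs) ++ subsets (suc k) xs

NonAttacking : Cell → Cell → Set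
NonAttacking (i , j) (i′ , j′) = i ≢ i′ × j ≢ j′

nonAttacking? : (r s : Cell) → Dec (NonAttacking r s)
nonAttacking? (i , j) (i′ , j′) = ¬? (i ℕₚ.≟ i′) ×-dec ¬? (j ℕₚ.≟ j′)

placements : ℕ → List ℕ → List (List Cell)
placements k μ = filter (allPairs? nonAttacking?) (subsets k (cells μ))

-- Cancels c r: the rook on r cancels c, i.e. c is weakly North of r in its
-- column or weakly West of r in its row.
Cancels : Cell → Cell → Set
Cancels (i , j) (i′ , j′) = (j ≡ j′ × i ≤ i′) ⊎ (i ≡ i′ × j ≤ j′)

cancels? : (c r : Cell) → Dec (Cancels c r)
cancels? (i , j) (i′ , j′) =
  (j ℕₚ.≟ j′ ×-dec i ℕₚ.≤? i′) ⊎-dec (i ℕₚ.≟ i′ ×-dec j ℕₚ.≤? j′)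

inv : List ℕ → List Cell → ℕ
inv μ p = length (filter (λ c → ¬? (any? (cancels? c) p)) (cells μ))

module Indeterminacy {c ℓ₁ ℓ₂ : Level} (K : HeytingField c ℓ₁ ℓ₂) where

  open HeytingField K
  open HeytingCommutativeRing heytingCommutativeRing using (commutativeRing)
  open CommutativeRing commutativeRing using (semiring)
  open Mult semiring using () renaming (_×_ to _·_)

  fromℤ : ℤ → Carrier
  fromℤ (+ n)    = n · 1#
  fromℤ -[1+ n ] = - (suc n · 1#)

  -- Integer polynomials are lists of coefficients, constant term first.
  eval : List ℤ → Carrier → Carrier
  eval p x = foldr (λ a v → fromℤ a + x * v) 0# p

  -- q is transcendental over ℤ: the value at q of a nonzero integer polynomial
  -- is nonzero.  Thus K has characteristic 0 and contains a copy of ℚ(q).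
  Indeterminate : Carrier → Set ℓ₂
  Indeterminate q = (p : List ℤ) → Any (_≢ 0ℤ) p → eval p q # 0#

module QRook {c ℓ₁ ℓ₂ : Level} (K : HeytingField c ℓ₁ ℓ₂)
             (q : HeytingField.Carrier K)
             (q-ind : Indeterminacy.Indeterminate K q) where

  open HeytingField K
  open HeytingCommutativeRing heytingCommutativeRing using (commutativeRing)
  open CommutativeRing commutativeRing using (ring; semiring)
  open Exp semiring using (_^_)
  open RingProperties ring using (-‿distribʳ-*)
  open HeytingProperties heytingCommutativeRing
  open Indeterminacy K using (fromℤ; eval)

  inverse : (x : Carrier) → x # 0# → Carrier
  inverse x x#0 = proj₁ (#⇒invertible x#0)

  inverse#0 : (x : Carrier) (x#0 : x # 0#) → inverse x x#0 # 0#
  inverse#0 x x#0 = invertibleʳ⇒# (x , trans (*-congʳ (x-0≈x _)) lemma)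
    where
    lemma : inverse x x#0 * x ≈ 1#
    lemma = trans (*-congˡ (sym (x-0≈x x))) (proj₁ (proj₂ (#⇒invertible x#0)))

  divide : Carrier → (y : Carrier) → y # 0# → Carrier
  divide x y y#0 = x * inverse y y#0

  fromℤ-1 : fromℤ 1ℤ ≈ 1#
  fromℤ-1 = +-identityʳ 1#

  q#0 : q # 0#
  q#0 = #-congʳ eval≈q (q-ind (0ℤ ∷ 1ℤ ∷ []) (there (here (λ ()))))
    where
    eval≈q : eval (0ℤ ∷ 1ℤ ∷ []) q ≈ q
    eval≈q = begin
      0# + q * (fromℤ 1ℤ + q * 0#) ≈⟨ +-identityˡ _ ⟩
      q * (fromℤ 1ℤ + q * 0#)      ≈⟨ *-congˡ (+-cong fromℤ-1 (zeroʳ q)) ⟩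
      q * (1# + 0#)                ≈⟨ *-congˡ (+-identityʳ 1#) ⟩
      q * 1#                       ≈⟨ *-identityʳ q ⟩
      q                            ∎
      where open ≈-Reasoning setoid

  1-q^#0 : (a : ℕ) → 1# - q ^ suc a # 0#
  1-q^#0 a =
    #-congʳ (+-cong fromℤ-1 (trans (*-congˡ (eval-shift a)) (sym (-‿distribʳ-* q (q ^ a)))))
            (q-ind (1ℤ ∷ shift a) (here (λ ())))
    where
    shift : ℕ → List ℤ
    shift b = replicate b 0ℤ ++ -1ℤ ∷ []

    eval-shift : (b : ℕ) → eval (shift b) q ≈ - (q ^ b)
    eval-shift zero = begin
      - (fromℤ 1ℤ) + q * 0# ≈⟨ +-cong (-‿cong fromℤ-1) (zeroʳ q) ⟩
      - 1# + 0#             ≈⟨ +-identityʳ (- 1#) ⟩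
      - 1#                  ∎
      where open ≈-Reasoning setoid
    eval-shift (suc b) = begin
      0# + q * eval (shift b) q ≈⟨ +-identityˡ _ ⟩
      q * eval (shift b) q      ≈⟨ *-congˡ (eval-shift b) ⟩
      q * - (q ^ b)             ≈⟨ -‿distribʳ-* q (q ^ b) ⟨
      - (q * q ^ b)             ∎
      where open ≈-Reasoning setoid

  1-q#0 : 1# - q # 0#
  1-q#0 = #-congʳ (+-congˡ (-‿cong (*-identityʳ q))) (1-q^#0 0)

  q^ : ℤ → Carrier
  q^ (+ n)    = q ^ n
  q^ -[1+ n ] = inverse q q#0 ^ suc n

  [_]q : ℤ → Carrier
  [ x ]q = divide (1# - q^ x) (1# - q) 1-q#0

  -- falling x k is [x][x-1]⋯[x-k+1].
  falling : ℤ → ℕ → Carrier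
  falling x zero    = 1#
  falling x (suc k) = [ x ]q * falling (x -ᶻ 1ℤ) k

  factorial : ℕ → Carrier
  factorial a = falling (+ a) a

  factorial#0 : (a : ℕ) → factorial a # 0#
  factorial#0 zero    = 1#0
  factorial#0 (suc a) =
    x#0y#0→xy#0 (x#0y#0→xy#0 (1-q^#0 a) (inverse#0 _ 1-q#0)) (factorial#0 a)

  ∑ : {A : Set} → List A → (A → Carrier) → Carrier
  ∑ xs f = foldr (λ x s → f x + s) 0# xs

  rook : ℕ → List ℕ → Carrier
  rook k μ = ∑ (placements k μ) (λ p → q ^ inv μ p)

  -- Polynomials in x over K are lists of coefficients, constant term first.
  Poly : Set c
  Poly = List Carrier

  coefficient : Poly → ℕ → Carrier
  coefficient []      _       = 0#
  coefficient (a ∷ f) zero    = a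
  coefficient (a ∷ f) (suc i) = coefficient f i

  infixl 6 _⊕_
  infixl 7 _⊗_ _⊙_

  _⊕_ : Poly → Poly → Poly
  []      ⊕ g       = g
  (a ∷ f) ⊕ []      = a ∷ f
  (a ∷ f) ⊕ (b ∷ g) = (a + b) ∷ (f ⊕ g)

  _⊙_ : Carrier → Poly → Poly
  a ⊙ f = map (a *_) f

  _⊗_ : Poly → Poly → Poly
  []      ⊗ g = []
  (a ∷ f) ⊗ g = (a ⊙ g) ⊕ (0# ∷ (f ⊗ g))

  -- (x;q)_k; the i-th factor is 1 - q^i x.
  pochhammer : ℕ → Poly
  pochhammer k = foldr (λ i f → (1# ∷ - (q ^ i) ∷ []) ⊗ f) (1# ∷ []) (upTo k)

  hitTerm : ℕ → List ℕ → ℕ → Poly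
  hitTerm m μ i =
    (rook i μ * factorial (m ∸ i) * (- 1#) ^ i * q^ (+ m *ᶻ + i -ᶻ + (i C 2)))
      ⊙ pochhammer i

  hitPolynomial : ℕ → ℕ → List ℕ → Poly
  hitPolynomial m n μ =
    divide (q^ (-ᶻ (+ size μ))) (factorial (m ∸ n)) (factorial#0 (m ∸ n))
      ⊙ foldr _⊕_ [] (map (hitTerm m μ) [ 0 ⋯ n ])

  -- hit k m n μ is the q-hit number with lower index k for the n × m board,
  -- i.e. the coefficient of x^k in its generating polynomial.
  hit : ℕ → ℕ → ℕ → List ℕ → Carrier
  hit k m n μ = coefficient (hitPolynomial m n μ) k

  module Identities (m n : ℕ) (μ : List ℕ) where

    HitColumn : Set ℓ₁
    HitColumn = (k : ℕ) → k ≤ n →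
      ∑ [ 1 ⋯ m ] (λ i →
        q^ (+ m +ᶻ + n -ᶻ + i -ᶻ + column μ i) * hit k (m ∸ 1) n (removeColumn i μ))
      ≈ [ + m -ᶻ + n ]q * hit k m n μ * q^ (+ n -ᶻ + k)

    HitRow : Set ℓ₁
    HitRow = (k : ℕ) → k < n →
      [ + m -ᶻ + n +ᶻ 1ℤ ]q *
        ∑ [ m ℕ.+ 1 ⋯ m ℕ.+ n ] (λ i →
          q^ (+ m +ᶻ + n -ᶻ + i -ᶻ + column μ i)
            * hit k m (n ∸ 1) (removeRow (m ℕ.+ n ℕ.+ 1 ∸ i) μ))
      ≈ hit k m n μ * q^ (+ k) * [ + n -ᶻ + k ]q + hit (k ℕ.+ 1) m n μ * [ + k +ᶻ 1ℤ ]q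

    HitCell : Set ℓ₁
    HitCell = (k : ℕ) → k < n →
      q^ (+ k) *
        ∑ (cells μ) (λ (i , j) →
          q^ (+ i +ᶻ (+ m -ᶻ + j -ᶻ + column μ j))
            * hit k (m ∸ 1) (n ∸ 1) (removeCell (i , j) μ))
      ≈ [ + k +ᶻ 1ℤ ]q * hit (k ℕ.+ 1) m n μ

    RookColumn : Set ℓ₁
    RookColumn = (k : ℕ) → k ≤ n →
      ∑ [ 1 ⋯ m ] (λ j → q^ (+ m -ᶻ + j) * rook k (removeColumn j μ))
      ≈ rook k μ * [ + m -ᶻ + k ]q
        - rook (k ℕ.+ 1) μ * (q^ (+ m) - q^ (+ m -ᶻ + k -ᶻ 1ℤ))

    RookRow : Set ℓ₁
    RookRow = (k : ℕ) → k ≤ n →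
      ∑ [ 1 ⋯ n ] (λ i → q^ (+ i -ᶻ 1ℤ +ᶻ + part μ i) * rook k (removeRow i μ))
      ≈ ([ + n ]q - [ + k ]q) * rook k μ

    RookCell : Set ℓ₁
    RookCell = (k : ℕ) → k < n →
      ∑ (cells μ) (λ (i , j) →
        q^ (+ i -ᶻ + j +ᶻ + part μ i) * rook k (removeCell (i , j) μ))
      ≈ q * [ + k +ᶻ 1ℤ ]q * rook (k ℕ.+ 1) μ

{-# OPTIONS --safe #-}
module Submission where

-- The polynomials (x;q)_i, 0 <= i <= n, are linearly independent, and the q-hit
-- numbers are by definition the coordinates in the monomials x^k of a
-- polynomial whose coordinates in the (x;q)_i are the R_i times nonzero
-- factors.  Write w(m,i) = [m-i]! (-1)^i q^(mi - C(i,2)), so that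
--   sum_k H_k^{m,n}(mu) x^k = q^(-|mu|) / [m-n]! sum_i R_i(mu) w(m,i) (x;q)_i.
-- Each family of q-hit identities turns out to be the system of x^k-coefficients
-- of one identity  sum_i A_i w_i (x;q)_i = sum_i B_i w_i (x;q)_i  (with x
-- replaced by qx in the third family), where A_i = B_i is the i-th q-rook
-- identity; expand⇔ then gives the equivalence.
--
-- On the side of the sums over smaller boards (hit-sum), the powers of q in the
-- q-hit identities absorb the change of |mu|, because the column lengths, row
-- lengths and sizes satisfy
--   |mu^[j]| + mu'_j = |mu|,   |mu_[i]| + mu_i = |mu|,
--   |mu/(i,j)| + mu'_j + mu_i = |mu| + 1.
-- On the other side, let c(i,k) be the coefficient of x^k in (x;q)_i.  The two
-- relations
--   (q^(i+1) - q^k) c(i+1,k) = q^k (q^(i+1) - 1) c(i,k),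
--   (1 - q^(k+1)) c(i,k+1) = (q^i - q^k) c(i,k)
-- and their consequence for c(i+1,k+1) express the operators acting on the hit
-- polynomial in the basis (x;q)_i:
--   columns: (x/q;q)_i = q^(-i) (x;q)_i + (1 - q^(-i)) (x;q)_{i-1};
--   rows:    the coefficients q^k [n-k] c(i,k) + [k+1] c(i,k+1) equal
--            ([n] - [i]) c(i,k);
--   cells:   the q-derivative of (x;q)_{i+1} is -[i+1] (qx;q)_i.
-- The weights are compared through w(m+1,i+1) = -q^(m+1) w(m,i) and
-- w(m+1,i) = [m+1-i] q^i w(m,i) for i <= m.
--
-- The ranges of k differ at the ends: in the column case a term with R_{n+1}
-- appears, and the q-rook row identity is also required for k = n, where it reads
-- 0 = 0.  Both are settled by R_k(mu) = 0 for k larger than the number of rows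
-- (rook-zero), the pigeonhole principle.

open import Defs
open import Algebra.Apartness.Bundles using (HeytingField; HeytingCommutativeRing)
open import Algebra.Bundles using (CommutativeRing)
import Algebra.Apartness.Properties.HeytingCommutativeRing as HeytingProperties
import Algebra.Properties.CommutativeSemigroup as CommutativeSemigroupProperties
import Algebra.Properties.Ring as RingProperties
import Algebra.Properties.Semiring.Exp as Exp
import Algebra.Properties.Semiring.Mult as Mult
import Algebra.Solver.Ring as RingSolver
open import Algebra.Solver.Ring.AlmostCommutativeRing
  using (fromCommutativeRing; _-Raw-AlmostCommutative⟶_)
open import Data.Bool.Base using (true; false)
open import Data.Fin.Base as Fin using (Fin; fromℕ<)
open import Data.Fin.Properties using (pigeonhole; fromℕ<-injective)
open import Data.Integer.Base as ℤ using (ℤ; +_; -[1+_]; 0ℤ; 1ℤ; _⊖_)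
  renaming (_+_ to _+ᶻ_; _-_ to _-ᶻ_; _*_ to _*ᶻ_; -_ to -ᶻ_)
import Data.Integer.Properties as ℤₚ
import Data.Integer.Tactic.RingSolver as ℤ-Solver
open import Data.List.Base
  using (List; []; _∷_; _++_; _∷ʳ_; map; concatMap; filter; foldr; length; lookup; upTo; applyUpTo)
open import Data.List.Membership.Propositional using (_∈_; find)
open import Data.List.Membership.Propositional.Properties
  using (∈-map⁻; ∈-++⁻; ∈-concatMap⁻; ∈-upTo⁻; ∈-lookup)
open import Data.List.Properties
  using (length-++; length-map; length-upTo; map-∘; map-cong; map-id; map-++; map-upTo; upTo-∷ʳ;
         foldr-∷ʳ; filter-++; filter-none; filter-accept; filter-reject)
open import Data.List.Relation.Unary.All as All using (All; []; _∷_)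
open import Data.List.Relation.Unary.AllPairs using (AllPairs; []; _∷_; allPairs?)
open import Data.List.Relation.Unary.Any using (here; there)
open import Data.Maybe.Base using (Maybe; just; nothing)
open import Data.Nat.Base as ℕ using (ℕ; zero; suc; _∸_; _≡ᵇ_; _≤_; _<_; z≤n; s≤s)
open import Data.Nat.Combinatorics using (_C_; nCk+nC[k+1]≡[n+1]C[k+1]; nC1≡n)
open import Data.Nat.ListAction using (sum)
import Data.Nat.Properties as ℕₚ
open import Data.Product.Base using (Σ; _×_; _,_; proj₁; proj₂)
open import Data.Sum.Base using (_⊎_; inj₁; inj₂)
open import Function.Base using (_∘_; id)
open import Function.Bundles using (_⇔_; mk⇔; Equivalence)
open import Relation.Binary.PropositionalEquality as ≡ using (_≡_; cong; cong₂; module ≡-Reasoning)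
import Relation.Binary.Reasoning.Setoid as SetoidReasoning
open import Relation.Nullary using (¬_; yes; no)
open import Relation.Unary using (Decidable)

-- Sums over the rows and the cells of a partition

range-last : (r : ℕ) → [ 1 ⋯ suc r ] ≡ [ 1 ⋯ r ] ∷ʳ suc r
range-last r = ≡.trans (cong (map suc) (≡.sym (upTo-∷ʳ r))) (map-++ suc (upTo r) (r ∷ []))

∈-range⁻ : {i r : ℕ} → i ∈ [ 1 ⋯ r ] → 1 ≤ i × i ≤ r
∈-range⁻ i∈ with t , t∈ , ≡.refl ← ∈-map⁻ suc i∈ = s≤s z≤n , ∈-upTo⁻ t∈

-- The parts, listed row by row, are the partition; so a sum over the rows of
-- μ is a sum over its list of parts.
map-part : (μ : List ℕ) → map (part μ) [ 1 ⋯ length μ ] ≡ μ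
map-part []      = ≡.refl
map-part (x ∷ μ) = cong (x ∷_) (begin
  map (part (x ∷ μ)) (map suc (applyUpTo suc l))
    ≡⟨ cong (map (part (x ∷ μ)) ∘ map suc) (map-upTo suc l) ⟨
  map (part (x ∷ μ)) (map suc (map suc (upTo l))) ≡⟨ map-∘ (map suc (upTo l)) ⟨
  map (part (x ∷ μ) ∘ suc) (map suc (upTo l))     ≡⟨ map-∘ (upTo l) ⟨
  map (part μ ∘ suc) (upTo l)                     ≡⟨ map-∘ (upTo l) ⟩
  map (part μ) (map suc (upTo l))                 ≡⟨ map-part μ ⟩
  μ                                               ∎)
  where
  open ≡-Reasoning
  l : ℕ
  l = length μ

count-concatMap : {A B : Set} {P : B → Set} (P? : Decidable P) (g : A → List B) (xs : List A) →
  length (filter P? (concatMap g xs)) ≡ sum (map (λ x → length (filter P? (g x))) xs)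
count-concatMap P? g []       = ≡.refl
count-concatMap P? g (x ∷ xs) = begin
  length (filter P? (g x ++ concatMap g xs))
    ≡⟨ cong length (filter-++ P? (g x) _) ⟩
  length (filter P? (g x) ++ filter P? (concatMap g xs))
    ≡⟨ length-++ (filter P? (g x)) ⟩
  length (filter P? (g x)) ℕ.+ length (filter P? (concatMap g xs))
    ≡⟨ cong (length (filter P? (g x)) ℕ.+_) (count-concatMap P? g xs) ⟩
  _ ∎
  where open ≡-Reasoning

length-concatMap : {A B : Set} (g : A → List B) (xs : List A) →
  length (concatMap g xs) ≡ sum (map (length ∘ g) xs)
length-concatMap g []       = ≡.refl
length-concatMap g (x ∷ xs) =
  ≡.trans (length-++ (g x)) (cong (length (g x) ℕ.+_) (length-concatMap g xs))

size-sum : (μ : List ℕ) → size μ ≡ sum μ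
size-sum μ = begin
  size μ
    ≡⟨ length-concatMap (λ i → map (i ,_) [ 1 ⋯ part μ i ]) [ 1 ⋯ length μ ] ⟩
  sum (map (λ i → length (map (i ,_) [ 1 ⋯ part μ i ])) [ 1 ⋯ length μ ])
    ≡⟨ cong sum (map-cong row-length [ 1 ⋯ length μ ]) ⟩
  sum (map (part μ) [ 1 ⋯ length μ ])
    ≡⟨ cong sum (map-part μ) ⟩
  sum μ ∎
  where
  open ≡-Reasoning
  row-length : ∀ i → length (map (i ,_) [ 1 ⋯ part μ i ]) ≡ part μ i
  row-length i = ≡.trans (length-map _ [ 1 ⋯ part μ i ])
                 (≡.trans (length-map suc (upTo (part μ i))) (length-upTo (part μ i)))

-- The number of cells in column j of a row of length r (0 or 1).
meets : ℕ → ℕ → ℕ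
meets j r = length (filter (ℕₚ._≟ j) [ 1 ⋯ r ])

column-sum : (μ : List ℕ) (j : ℕ) → column μ j ≡ sum (map (meets j) μ)
column-sum μ j = begin
  column μ j
    ≡⟨ count-concatMap (λ c → proj₂ c ℕₚ.≟ j) _ [ 1 ⋯ length μ ] ⟩
  sum (map (λ i → length (filter (λ c → proj₂ c ℕₚ.≟ j) (map (i ,_) [ 1 ⋯ part μ i ])))
           [ 1 ⋯ length μ ])
    ≡⟨ cong sum (map-cong (λ i → row i [ 1 ⋯ part μ i ]) [ 1 ⋯ length μ ]) ⟩
  sum (map (meets j ∘ part μ) [ 1 ⋯ length μ ])
    ≡⟨ cong sum (map-∘ [ 1 ⋯ length μ ]) ⟩
  sum (map (meets j) (map (part μ) [ 1 ⋯ length μ ]))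
    ≡⟨ cong (sum ∘ map (meets j)) (map-part μ) ⟩
  sum (map (meets j) μ) ∎
  where
  open ≡-Reasoning
  row : (i : ℕ) (js : List ℕ) →
    length (filter (λ c → proj₂ c ℕₚ.≟ j) (map (i ,_) js)) ≡ length (filter (ℕₚ._≟ j) js)
  row i []        = ≡.refl
  -- filter inspects only the Boolean part of the decision of j′ ≡ j.
  row i (j′ ∷ js) with j′ ≡ᵇ j
  ... | true  = cong suc (row i js)
  ... | false = row i js

meets-suc : (j r : ℕ) → meets j (suc r) ≡ meets j r ℕ.+ length (filter (ℕₚ._≟ j) (suc r ∷ []))
meets-suc j r = begin
  length (filter (ℕₚ._≟ j) [ 1 ⋯ suc r ])
    ≡⟨ cong (length ∘ filter (ℕₚ._≟ j)) (range-last r) ⟩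
  length (filter (ℕₚ._≟ j) ([ 1 ⋯ r ] ∷ʳ suc r))
    ≡⟨ cong length (filter-++ (ℕₚ._≟ j) [ 1 ⋯ r ] _) ⟩
  length (filter (ℕₚ._≟ j) [ 1 ⋯ r ] ++ filter (ℕₚ._≟ j) (suc r ∷ []))
    ≡⟨ length-++ (filter (ℕₚ._≟ j) [ 1 ⋯ r ]) ⟩
  _ ∎
  where open ≡-Reasoning

meets-outside : (j r : ℕ) → r < j → meets j r ≡ 0
meets-outside j zero    _   = ≡.refl
meets-outside j (suc r) r<j = ≡.trans (meets-suc j r) (cong₂ ℕ._+_
  (meets-outside j r (ℕₚ.<⇒≤ r<j))
  (cong length (filter-reject (ℕₚ._≟ j) (ℕₚ.<⇒≢ r<j))))

meets-inside : (j r : ℕ) → 1 ≤ j → j ≤ r → meets j r ≡ 1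
meets-inside (suc _) zero    _   ()
meets-inside j       (suc r) 1≤j j≤r with ℕₚ.m≤n⇒m<n∨m≡n j≤r
... | inj₁ (s≤s j≤r′) = ≡.trans (meets-suc j r) (cong₂ ℕ._+_
  (meets-inside j r 1≤j j≤r′)
  (cong length (filter-reject (ℕₚ._≟ j) (ℕₚ.<⇒≢ (s≤s j≤r′) ∘ ≡.sym))))
... | inj₂ ≡.refl = ≡.trans (meets-suc j r) (cong₂ ℕ._+_
  (meets-outside j r ℕₚ.≤-refl)
  (cong length (filter-accept (ℕₚ._≟ j) {xs = []} ≡.refl)))

-- Removing rows and columns

shorten-meets : (j r : ℕ) → 1 ≤ j → shorten j r ℕ.+ meets j r ≡ r
shorten-meets j r 1≤j with j ℕₚ.≤? r
... | yes j≤r = ≡.trans (cong (r ∸ 1 ℕ.+_) (meets-inside j r 1≤j j≤r))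
                      (ℕₚ.m∸n+n≡m (ℕₚ.≤-trans 1≤j j≤r))
... | no  j≰r = ≡.trans (cong (r ℕ.+_) (meets-outside j r (ℕₚ.≰⇒> j≰r))) (ℕₚ.+-identityʳ r)

size-removeColumn : (j : ℕ) (μ : List ℕ) → 1 ≤ j → size (removeColumn j μ) ℕ.+ column μ j ≡ size μ
size-removeColumn j μ 1≤j = begin
  size (removeColumn j μ) ℕ.+ column μ j
    ≡⟨ cong₂ ℕ._+_ (size-sum (removeColumn j μ)) (column-sum μ j) ⟩
  sum (map (shorten j) μ) ℕ.+ sum (map (meets j) μ)
    ≡⟨ rowwise μ ⟩
  sum μ
    ≡⟨ size-sum μ ⟨
  size μ ∎
  where
  open ≡-Reasoning
  rowwise : ∀ ν → sum (map (shorten j) ν) ℕ.+ sum (map (meets j) ν) ≡ sum ν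
  rowwise []      = ≡.refl
  rowwise (r ∷ ν) = ≡.trans (interchange (shorten j r) _ (meets j r) _)
                          (cong₂ ℕ._+_ (shorten-meets j r 1≤j) (rowwise ν))
    where open CommutativeSemigroupProperties ℕₚ.+-commutativeSemigroup using (interchange)

-- Any quantity summed over the parts, such as the size or a column length.
sum-removeRow : (f : ℕ → ℕ) (i : ℕ) (μ : List ℕ) → 1 ≤ i → i ≤ length μ →
  sum (map f (removeRow i μ)) ℕ.+ f (part μ i) ≡ sum (map f μ)
sum-removeRow f (suc i)       []      _ ()
sum-removeRow f (suc zero)    (x ∷ μ) _ _         = ℕₚ.+-comm _ (f x)
sum-removeRow f (suc (suc i)) (x ∷ μ) _ (s≤s i≤l) =
  ≡.trans (ℕₚ.+-assoc (f x) _ _) (cong (f x ℕ.+_) (sum-removeRow f (suc i) μ (s≤s z≤n) i≤l))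

size-removeRow : (i : ℕ) (μ : List ℕ) → 1 ≤ i → i ≤ length μ →
  size (removeRow i μ) ℕ.+ part μ i ≡ size μ
size-removeRow i μ 1≤i i≤l = begin
  size (removeRow i μ) ℕ.+ part μ i         ≡⟨ cong (ℕ._+ part μ i) (size-sum (removeRow i μ)) ⟩
  sum (removeRow i μ) ℕ.+ part μ i          ≡⟨ cong (λ ν → sum ν ℕ.+ part μ i) (map-id (removeRow i μ)) ⟨
  sum (map id (removeRow i μ)) ℕ.+ part μ i ≡⟨ sum-removeRow id i μ 1≤i i≤l ⟩
  sum (map id μ)                            ≡⟨ cong sum (map-id μ) ⟩
  sum μ                                     ≡⟨ size-sum μ ⟨
  size μ                                    ∎
  where
  open ≡-Reasoning

∈-cells⁻ : {i j : ℕ} (μ : List ℕ) → (i , j) ∈ cells μ →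
  (1 ≤ i × i ≤ length μ) × (1 ≤ j × j ≤ part μ i)
∈-cells⁻ μ c∈
  with i , i∈ , c∈row ← find (∈-concatMap⁻ (λ i → map (i ,_) [ 1 ⋯ part μ i ]) {xs = [ 1 ⋯ length μ ]} c∈)
  with j , j∈ , ≡.refl  ← ∈-map⁻ (i ,_) c∈row
  = ∈-range⁻ i∈ , ∈-range⁻ j∈

size-removeCell : {i j : ℕ} (μ : List ℕ) → (i , j) ∈ cells μ →
  size (removeCell (i , j) μ) ℕ.+ column μ j ℕ.+ part μ i ≡ suc (size μ)
size-removeCell {i} {j} μ c∈ with (1≤i , i≤l) , (1≤j , j≤r) ← ∈-cells⁻ μ c∈ = begin
  size (removeCell (i , j) μ) ℕ.+ column μ j ℕ.+ part μ i
    ≡⟨ cong (λ x → size (removeCell (i , j) μ) ℕ.+ x ℕ.+ part μ i) column-removeRow ⟩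
  size (removeCell (i , j) μ) ℕ.+ suc (column (removeRow i μ) j) ℕ.+ part μ i
    ≡⟨ cong (ℕ._+ part μ i) (ℕₚ.+-suc _ _) ⟩
  suc (size (removeCell (i , j) μ) ℕ.+ column (removeRow i μ) j ℕ.+ part μ i)
    ≡⟨ cong (λ x → suc (x ℕ.+ part μ i)) (size-removeColumn j (removeRow i μ) 1≤j) ⟩
  suc (size (removeRow i μ) ℕ.+ part μ i)
    ≡⟨ cong suc (size-removeRow i μ 1≤i i≤l) ⟩
  suc (size μ) ∎
  where
  open ≡-Reasoning
  column-removeRow : column μ j ≡ suc (column (removeRow i μ) j)
  column-removeRow = begin
    column μ j
      ≡⟨ column-sum μ j ⟩
    sum (map (meets j) μ)
      ≡⟨ sum-removeRow (meets j) i μ 1≤i i≤l ⟨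
    sum (map (meets j) (removeRow i μ)) ℕ.+ meets j (part μ i)
      ≡⟨ cong₂ ℕ._+_ (≡.sym (column-sum (removeRow i μ) j)) (meets-inside j (part μ i) 1≤j j≤r) ⟩
    column (removeRow i μ) j ℕ.+ 1
      ≡⟨ ℕₚ.+-comm _ 1 ⟩
    suc (column (removeRow i μ) j) ∎

column-outside : (μ : List ℕ) {m : ℕ} (j : ℕ) → All (_≤ m) μ → m < j → column μ j ≡ 0
column-outside μ j μ≤m m<j = ≡.trans (column-sum μ j) (rowwise μ≤m)
  where
  rowwise : ∀ {ν} → All (_≤ _) ν → sum (map (meets j) ν) ≡ 0
  rowwise []                  = ≡.refl
  rowwise (_∷_ {x = r} r≤m h) = cong₂ ℕ._+_ (meets-outside j r (ℕₚ.≤-<-trans r≤m m<j)) (rowwise h)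

length-removeRow : (i : ℕ) (μ : List ℕ) → 1 ≤ i → i ≤ length μ → suc (length (removeRow i μ)) ≡ length μ
length-removeRow (suc i)       []      _ ()
length-removeRow (suc zero)    (x ∷ μ) _ _         = ≡.refl
length-removeRow (suc (suc i)) (x ∷ μ) _ (s≤s i≤l) = cong suc (length-removeRow (suc i) μ (s≤s z≤n) i≤l)

-- Placements have at most one rook per row

∈-subsets⁻ : {A : Set} (k : ℕ) (xs : List A) {p : List A} →
  p ∈ subsets k xs → length p ≡ k × All (_∈ xs) p
∈-subsets⁻ zero    xs       (here ≡.refl) = ≡.refl , []
∈-subsets⁻ (suc k) (x ∷ xs) p∈ with ∈-++⁻ (map (x ∷_) (subsets k xs)) p∈
... | inj₁ p∈₁ with p′ , p′∈ , ≡.refl ← ∈-map⁻ (x ∷_) p∈₁ with eq , h ← ∈-subsets⁻ k xs p′∈ =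
  cong suc eq , here ≡.refl ∷ All.map there h
... | inj₂ p∈₂ with eq , h ← ∈-subsets⁻ (suc k) xs p∈₂ = eq , All.map there h

lookup-allPairs : {A : Set} {R : A → A → Set} {xs : List A} → AllPairs R xs →
  (i j : Fin (length xs)) → i Fin.< j → R (lookup xs i) (lookup xs j)
lookup-allPairs (h ∷ _)  Fin.zero    (Fin.suc j) _         = All.lookup h (∈-lookup j)
lookup-allPairs (_ ∷ hs) (Fin.suc i) (Fin.suc j) (s≤s i<j) = lookup-allPairs hs i j i<j

-- Pigeonhole on the row indices.
nonAttacking-length : (μ : List ℕ) (p : List Cell) → All (_∈ cells μ) p →
  AllPairs NonAttacking p → length p ≤ length μ
nonAttacking-length μ p p⊆ na = ℕₚ.≮⇒≥ λ l<p →
  let i , j , i<j , eq = pigeonhole l<p row in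
  proj₁ (lookup-allPairs na i j i<j)
    (ℕₚ.∸-cancelʳ-≡ (1≤row i) (1≤row j) (fromℕ<-injective _ _ (row< i) (row< j) eq))
  where
  bounds : (i : Fin (length p)) → 1 ≤ proj₁ (lookup p i) × proj₁ (lookup p i) ≤ length μ
  bounds i = proj₁ (∈-cells⁻ μ (All.lookup p⊆ (∈-lookup i)))
  1≤row : (i : Fin (length p)) → 1 ≤ proj₁ (lookup p i)
  1≤row i = proj₁ (bounds i)
  -- Rows are numbered from 1, elements of Fin from 0.
  row< : (i : Fin (length p)) → proj₁ (lookup p i) ∸ 1 < length μ
  row< i = ℕₚ.<-≤-trans (ℕₚ.≤-reflexive (ℕₚ.m+[n∸m]≡n (1≤row i))) (proj₂ (bounds i))
  row : Fin (length p) → Fin (length μ)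
  row i = fromℕ< (row< i)

placements-none : (k : ℕ) (μ : List ℕ) → length μ < k → placements k μ ≡ []
placements-none k μ l<k = filter-none (allPairs? nonAttacking?) (All.tabulate attacking)
  where
  attacking : {p : List Cell} → p ∈ subsets k (cells μ) → ¬ AllPairs NonAttacking p
  attacking {p} p∈ na with ≡.refl , p⊆ ← ∈-subsets⁻ k (cells μ) p∈ =
    ℕₚ.<⇒≱ l<k (nonAttacking-length μ p p⊆ na)

-- Arithmetic of exponents

choose-two : (i : ℕ) → suc i C 2 ≡ i ℕ.+ i C 2
choose-two i = ≡.trans (≡.sym (nCk+nC[k+1]≡[n+1]C[k+1] i 1)) (cong (ℕ._+ i C 2) (nC1≡n i))

pos-∸ : {m n : ℕ} → n ≤ m → + (m ∸ n) ≡ + m -ᶻ + n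
pos-∸ {m} {n} n≤m = ≡.sym (≡.trans (ℤₚ.m-n≡m⊖n m n) (ℤₚ.⊖-≥ n≤m))

module HitRook {c ℓ₁ ℓ₂} (K : HeytingField c ℓ₁ ℓ₂)
               (q : HeytingField.Carrier K)
               (q-ind : Indeterminacy.Indeterminate K q) where

  open HeytingField K
  open HeytingCommutativeRing heytingCommutativeRing using (commutativeRing)
  open CommutativeRing commutativeRing using (ring; semiring)
  open Exp semiring using (_^_; ^-homo-*)
  open Mult semiring using (×-homo-+; ×1-homo-*) renaming (_×_ to _·_)
  open RingProperties ring
    using (-0#≈0#; -‿involutive; -‿+-comm; -‿distribˡ-*; -‿distribʳ-*)
  open HeytingProperties heytingCommutativeRing using (x-0≈x)
  open Indeterminacy K using (fromℤ)
  open QRook K q q-ind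
  open SetoidReasoning setoid

  -- Integer coefficients

  -- fromℤ is a ring homomorphism.  ℤ serves as the coefficient ring of the ring
  -- solver, which needs to recognise that integer coefficients cancel.
  fromℤ-⊖ : (m n : ℕ) → fromℤ (m ⊖ n) ≈ m · 1# - n · 1#
  fromℤ-⊖ m       zero    = sym (trans (+-congˡ -0#≈0#) (+-identityʳ _))
  fromℤ-⊖ zero    (suc n) = sym (+-identityˡ _)
  fromℤ-⊖ (suc m) (suc n) = begin
    fromℤ (suc m ⊖ suc n)              ≡⟨ cong fromℤ (ℤₚ.[1+m]⊖[1+n]≡m⊖n m n) ⟩
    fromℤ (m ⊖ n)                      ≈⟨ fromℤ-⊖ m n ⟩
    m · 1# - n · 1#                    ≈⟨ +-identityˡ _ ⟨
    0# + (m · 1# - n · 1#)             ≈⟨ +-congʳ (-‿inverseʳ 1#) ⟨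
    1# - 1# + (m · 1# - n · 1#)        ≈⟨ +-assoc 1# (- 1#) _ ⟩
    1# + (- 1# + (m · 1# - n · 1#))    ≈⟨ +-congˡ (+-comm _ _) ⟩
    1# + (m · 1# - n · 1# + - 1#)      ≈⟨ +-congˡ (+-assoc _ _ _) ⟩
    1# + (m · 1# + (- (n · 1#) + - 1#)) ≈⟨ +-congˡ (+-congˡ (trans (+-comm _ _) (-‿+-comm _ _))) ⟩
    1# + (m · 1# - suc n · 1#)         ≈⟨ +-assoc _ _ _ ⟨
    suc m · 1# - suc n · 1#            ∎

  fromℤ-+ : (a b : ℤ) → fromℤ (a +ᶻ b) ≈ fromℤ a + fromℤ b
  fromℤ-+ (+ m)    (+ n)    = ×-homo-+ 1# m n
  fromℤ-+ (+ m)    -[1+ n ] = fromℤ-⊖ m (suc n)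
  fromℤ-+ -[1+ m ] (+ n)    = trans (fromℤ-⊖ n (suc m)) (+-comm _ _)
  fromℤ-+ -[1+ m ] -[1+ n ] = begin
    - (suc (suc (m ℕ.+ n)) · 1#)     ≡⟨ cong (λ x → - (suc x · 1#)) (ℕₚ.+-suc m n) ⟨
    - ((suc m ℕ.+ suc n) · 1#)       ≈⟨ -‿cong (×-homo-+ 1# (suc m) (suc n)) ⟩
    - (suc m · 1# + suc n · 1#)      ≈⟨ -‿+-comm _ _ ⟨
    - (suc m · 1#) + - (suc n · 1#)  ∎

  fromℤ-neg : (a : ℤ) → fromℤ (-ᶻ a) ≈ - fromℤ a
  fromℤ-neg (+ zero)  = sym -0#≈0#
  fromℤ-neg (+ suc n) = refl
  fromℤ-neg -[1+ n ]  = sym (-‿involutive _)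

  fromℤ-* : (a b : ℤ) → fromℤ (a *ᶻ b) ≈ fromℤ a * fromℤ b
  fromℤ-* (+ m)    b        = nonneg m b
    where
    nonneg : (m : ℕ) (b : ℤ) → fromℤ (+ m *ᶻ b) ≈ m · 1# * fromℤ b
    nonneg m (+ n)    = trans (reflexive (cong fromℤ (≡.sym (ℤₚ.pos-* m n)))) (×1-homo-* m n)
    nonneg m -[1+ n ] = begin
      fromℤ (+ m *ᶻ -ᶻ (+ suc n))  ≡⟨ cong fromℤ (ℤₚ.neg-distribʳ-* (+ m) (+ suc n)) ⟨
      fromℤ (-ᶻ (+ m *ᶻ + suc n))  ≈⟨ fromℤ-neg (+ m *ᶻ + suc n) ⟩
      - fromℤ (+ m *ᶻ + suc n)     ≈⟨ -‿cong (nonneg m (+ suc n)) ⟩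
      - (m · 1# * suc n · 1#)      ≈⟨ -‿distribʳ-* _ _ ⟩
      m · 1# * - (suc n · 1#)      ∎
  fromℤ-* -[1+ m ] b        = begin
    fromℤ (-ᶻ (+ suc m) *ᶻ b)  ≡⟨ cong fromℤ (ℤₚ.neg-distribˡ-* (+ suc m) b) ⟨
    fromℤ (-ᶻ (+ suc m *ᶻ b))  ≈⟨ fromℤ-neg (+ suc m *ᶻ b) ⟩
    - fromℤ (+ suc m *ᶻ b)     ≈⟨ -‿cong (fromℤ-* (+ suc m) b) ⟩
    - (suc m · 1# * fromℤ b)   ≈⟨ -‿distribˡ-* _ _ ⟩
    - (suc m · 1#) * fromℤ b   ∎

  fromℤ-morphism : ℤ.+-*-rawRing -Raw-AlmostCommutative⟶ fromCommutativeRing commutativeRing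
  fromℤ-morphism = record
    { ⟦_⟧    = fromℤ
    ; +-homo = fromℤ-+
    ; *-homo = fromℤ-*
    ; -‿homo = fromℤ-neg
    ; 0-homo = refl
    ; 1-homo = fromℤ-1
    }

  fromℤ-≟ : (a b : ℤ) → Maybe (fromℤ a ≈ fromℤ b)
  fromℤ-≟ a b with a ℤₚ.≟ b
  ... | yes ≡.refl = just refl
  ... | no  _      = nothing

  open RingSolver ℤ.+-*-rawRing (fromCommutativeRing commutativeRing) fromℤ-morphism fromℤ-≟
    using (Polynomial; con; solve; _:=_; _:+_; _:*_; _:-_; :-_; _:^_)

  -- An empty product, which evaluates to 1#; con 1ℤ would evaluate to 1# + 0#.
  :1 : {n : ℕ} → Polynomial n
  :1 = con 0ℤ :^ 0

  -- Units

  -- Invertible elements, with a left inverse only, as multiplication commutes.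
  Unit : Carrier → Set _
  Unit x = Σ Carrier λ y → y * x ≈ 1#

  unit-* : {x y : Carrier} → Unit x → Unit y → Unit (x * y)
  unit-* {x} {y} (x⁻¹ , ex) (y⁻¹ , ey) = x⁻¹ * y⁻¹ , (begin
    x⁻¹ * y⁻¹ * (x * y)   ≈⟨ solve 4 (λ a b c d → a :* b :* (c :* d) := a :* c :* (b :* d)) refl _ _ _ _ ⟩
    x⁻¹ * x * (y⁻¹ * y)   ≈⟨ *-cong ex ey ⟩
    1# * 1#               ≈⟨ *-identityˡ 1# ⟩
    1#                    ∎)

  unit-^ : {x : Carrier} → Unit x → (k : ℕ) → Unit (x ^ k)
  unit-^ ux zero    = 1# , *-identityˡ 1#
  unit-^ ux (suc k) = unit-* ux (unit-^ ux k)

  unit-neg : {x : Carrier} → Unit x → Unit (- x)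
  unit-neg {x} (x⁻¹ , ex) =
    - x⁻¹ , trans (solve 2 (λ a b → :- a :* :- b := a :* b) refl x⁻¹ x) ex

  unit-resp : {x y : Carrier} → x ≈ y → Unit x → Unit y
  unit-resp x≈y (x⁻¹ , ex) = x⁻¹ , trans (*-congˡ (sym x≈y)) ex

  unit-cancelˡ : {x a b : Carrier} → Unit x → x * a ≈ x * b → a ≈ b
  unit-cancelˡ {x} {a} {b} (x⁻¹ , ex) xa≈xb = begin
    a              ≈⟨ recover a ⟨
    x⁻¹ * (x * a)  ≈⟨ *-congˡ xa≈xb ⟩
    x⁻¹ * (x * b)  ≈⟨ recover b ⟩
    b              ∎
    where
    recover : ∀ y → x⁻¹ * (x * y) ≈ y
    recover y = trans (sym (*-assoc _ _ _)) (trans (*-congʳ ex) (*-identityˡ y))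

  unit-cancelʳ : {x a b : Carrier} → Unit x → a * x ≈ b * x → a ≈ b
  unit-cancelʳ ux ax≈bx = unit-cancelˡ ux (trans (*-comm _ _) (trans ax≈bx (*-comm _ _)))

  inverse-* : {x : Carrier} (x#0 : x # 0#) → inverse x x#0 * x ≈ 1#
  inverse-* {x} x#0 = trans (*-congˡ (sym (x-0≈x x))) (proj₁ (proj₂ (#⇒invertible x#0)))

  #⇒unit : {x : Carrier} → x # 0# → Unit x
  #⇒unit x#0 = inverse _ x#0 , inverse-* x#0

  -- Powers of q, brackets and factorials

  q^-⊖ : (m n : ℕ) → q^ (m ⊖ n) ≈ q ^ m * inverse q q#0 ^ n
  q^-⊖ m       zero    = sym (*-identityʳ _)
  q^-⊖ zero    (suc n) = sym (*-identityˡ _)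
  q^-⊖ (suc m) (suc n) = begin
    q^ (suc m ⊖ suc n)              ≡⟨ cong q^ (ℤₚ.[1+m]⊖[1+n]≡m⊖n m n) ⟩
    q^ (m ⊖ n)                      ≈⟨ q^-⊖ m n ⟩
    q ^ m * r ^ n                   ≈⟨ *-identityˡ _ ⟨
    1# * (q ^ m * r ^ n)            ≈⟨ *-congʳ (inverse-* q#0) ⟨
    r * q * (q ^ m * r ^ n)
      ≈⟨ solve 4 (λ a b c d → a :* b :* (c :* d) := b :* c :* (a :* d)) refl _ _ _ _ ⟩
    q ^ suc m * r ^ suc n           ∎
    where
    r : Carrier
    r = inverse q q#0

  q^-+ : (a b : ℤ) → q^ (a +ᶻ b) ≈ q^ a * q^ b
  q^-+ (+ m)    (+ n)    = ^-homo-* q m n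
  q^-+ (+ m)    -[1+ n ] = q^-⊖ m (suc n)
  q^-+ -[1+ m ] (+ n)    = trans (q^-⊖ n (suc m)) (*-comm _ _)
  q^-+ -[1+ m ] -[1+ n ] = begin
    r ^ suc (suc (m ℕ.+ n))  ≡⟨ cong (λ x → r ^ suc x) (ℕₚ.+-suc m n) ⟨
    r ^ (suc m ℕ.+ suc n)    ≈⟨ ^-homo-* r (suc m) (suc n) ⟩
    r ^ suc m * r ^ suc n    ∎
    where
    r : Carrier
    r = inverse q q#0

  q^-split : {a : ℤ} (b d : ℤ) → a ≡ b +ᶻ d → q^ a ≈ q^ b * q^ d
  q^-split b d ≡.refl = q^-+ b d

  q^-neg : (a : ℤ) → q^ (-ᶻ a) * q^ a ≈ 1#
  q^-neg a = trans (sym (q^-+ (-ᶻ a) a)) (reflexive (cong q^ (ℤₚ.+-inverseˡ a)))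

  unit-q^ : (a : ℤ) → Unit (q^ a)
  unit-q^ a = q^ (-ᶻ a) , q^-neg a

  factorial⁻¹ : ℕ → Carrier
  factorial⁻¹ a = inverse (factorial a) (factorial#0 a)

  bracket-factorial⁻¹ : (a : ℕ) → [ + suc a ]q * factorial⁻¹ (suc a) ≈ factorial⁻¹ a
  bracket-factorial⁻¹ a = unit-cancelʳ (#⇒unit (factorial#0 a)) (begin
    [ + suc a ]q * factorial⁻¹ (suc a) * factorial a
      ≈⟨ solve 3 (λ x y z → x :* y :* z := y :* (x :* z)) refl _ _ _ ⟩
    factorial⁻¹ (suc a) * factorial (suc a)
      ≈⟨ inverse-* (factorial#0 (suc a)) ⟩
    1#
      ≈⟨ inverse-* (factorial#0 a) ⟨
    factorial⁻¹ a * factorial a ∎)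

  -- Finite sums

  ∑-cong : {A : Set} (xs : List A) {f g : A → Carrier} →
    (∀ {x} → x ∈ xs → f x ≈ g x) → ∑ xs f ≈ ∑ xs g
  ∑-cong []       h = refl
  ∑-cong (x ∷ xs) h = +-cong (h (here ≡.refl)) (∑-cong xs (h ∘ there))

  ∑-+ : {A : Set} (xs : List A) (f g : A → Carrier) → ∑ xs (λ x → f x + g x) ≈ ∑ xs f + ∑ xs g
  ∑-+ []       f g = sym (+-identityˡ 0#)
  ∑-+ (x ∷ xs) f g = trans (+-congˡ (∑-+ xs f g))
    (solve 4 (λ a b c d → a :+ b :+ (c :+ d) := a :+ c :+ (b :+ d)) refl _ _ _ _)

  ∑-*ˡ : {A : Set} (a : Carrier) (xs : List A) (f : A → Carrier) →
    a * ∑ xs f ≈ ∑ xs (λ x → a * f x)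
  ∑-*ˡ a []       f = zeroʳ a
  ∑-*ˡ a (x ∷ xs) f = trans (distribˡ a _ _) (+-congˡ (∑-*ˡ a xs f))

  ∑-*ʳ : {A : Set} (xs : List A) (f : A → Carrier) (a : Carrier) →
    ∑ xs f * a ≈ ∑ xs (λ x → f x * a)
  ∑-*ʳ []       f a = zeroˡ a
  ∑-*ʳ (x ∷ xs) f a = trans (distribʳ a _ _) (+-congˡ (∑-*ʳ xs f a))

  ∑-zero : {A : Set} (xs : List A) {f : A → Carrier} → (∀ {x} → x ∈ xs → f x ≈ 0#) → ∑ xs f ≈ 0#
  ∑-zero []       h = refl
  ∑-zero (x ∷ xs) h = trans (+-cong (h (here ≡.refl)) (∑-zero xs (h ∘ there))) (+-identityˡ 0#)

  ∑-swap : {A B : Set} (xs : List A) (ys : List B) (f : A → B → Carrier) →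
    ∑ xs (λ x → ∑ ys (f x)) ≈ ∑ ys (λ y → ∑ xs (λ x → f x y))
  ∑-swap []       ys f = sym (∑-zero ys (λ _ → refl))
  ∑-swap (x ∷ xs) ys f = trans (+-congˡ (∑-swap xs ys f)) (sym (∑-+ ys _ _))

  ∑-map : {A B : Set} (g : A → B) (xs : List A) (f : B → Carrier) → ∑ (map g xs) f ≡ ∑ xs (f ∘ g)
  ∑-map g []       f = ≡.refl
  ∑-map g (x ∷ xs) f = cong (λ s → f (g x) + s) (∑-map g xs f)

  ∑-first : (n : ℕ) (f : ℕ → Carrier) → ∑ (upTo (suc n)) f ≡ f 0 + ∑ (upTo n) (f ∘ suc)
  ∑-first n f = cong (λ s → f 0 + s)
    (≡.trans (cong (λ xs → ∑ xs f) (≡.sym (map-upTo suc n))) (∑-map suc (upTo n) f))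

  ∑-∷ʳ : {A : Set} (xs : List A) (x : A) (f : A → Carrier) → ∑ (xs ∷ʳ x) f ≈ ∑ xs f + f x
  ∑-∷ʳ []       x f = +-comm _ _
  ∑-∷ʳ (y ∷ xs) x f = trans (+-congˡ (∑-∷ʳ xs x f)) (sym (+-assoc _ _ _))

  ∑-last : (n : ℕ) (f : ℕ → Carrier) → ∑ (upTo (suc n)) f ≈ ∑ (upTo n) f + f n
  ∑-last n f = trans (reflexive (cong (λ xs → ∑ xs f) (≡.sym (upTo-∷ʳ n)))) (∑-∷ʳ (upTo n) n f)

  -- Moving the index by one costs nothing when both end terms vanish.
  ∑-shift : (n : ℕ) (f : ℕ → Carrier) → f 0 ≈ 0# → f n ≈ 0# →
    ∑ (upTo n) f ≈ ∑ (upTo n) (f ∘ suc)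
  ∑-shift n f f0≈0 fn≈0 = begin
    ∑ (upTo n) f              ≈⟨ trans (+-congˡ fn≈0) (+-identityʳ _) ⟨
    ∑ (upTo n) f + f n        ≈⟨ ∑-last n f ⟨
    ∑ (upTo (suc n)) f        ≡⟨ ∑-first n f ⟩
    f 0 + ∑ (upTo n) (f ∘ suc) ≈⟨ trans (+-congʳ f0≈0) (+-identityˡ _) ⟩
    ∑ (upTo n) (f ∘ suc)      ∎

  ∑-reverse : (n : ℕ) (f : ℕ → Carrier) → ∑ (upTo n) (λ t → f (n ∸ t)) ≈ ∑ [ 1 ⋯ n ] f
  ∑-reverse zero    f = refl
  ∑-reverse (suc n) f = begin
    ∑ (upTo (suc n)) (λ t → f (suc n ∸ t))   ≡⟨ ∑-first n (λ t → f (suc n ∸ t)) ⟩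
    f (suc n) + ∑ (upTo n) (λ t → f (n ∸ t)) ≈⟨ +-congˡ (∑-reverse n f) ⟩
    f (suc n) + ∑ [ 1 ⋯ n ] f                ≈⟨ +-comm _ _ ⟩
    ∑ [ 1 ⋯ n ] f + f (suc n)                ≈⟨ ∑-∷ʳ [ 1 ⋯ n ] (suc n) f ⟨
    ∑ ([ 1 ⋯ n ] ∷ʳ suc n) f                 ≡⟨ cong (λ xs → ∑ xs f) (range-last n) ⟨
    ∑ [ 1 ⋯ suc n ] f                        ∎

  -- Coefficients of polynomials

  coefficient-⊕ : (f g : Poly) (k : ℕ) → coefficient (f ⊕ g) k ≈ coefficient f k + coefficient g k
  coefficient-⊕ []      g       k       = sym (+-identityˡ _)
  coefficient-⊕ (a ∷ f) []      k       = sym (+-identityʳ _)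
  coefficient-⊕ (a ∷ f) (b ∷ g) zero    = refl
  coefficient-⊕ (a ∷ f) (b ∷ g) (suc k) = coefficient-⊕ f g k

  coefficient-⊙ : (a : Carrier) (f : Poly) (k : ℕ) → coefficient (a ⊙ f) k ≈ a * coefficient f k
  coefficient-⊙ a []      k       = sym (zeroʳ a)
  coefficient-⊙ a (b ∷ f) zero    = refl
  coefficient-⊙ a (b ∷ f) (suc k) = coefficient-⊙ a f k

  coefficient-∑ : {A : Set} (t : A → Poly) (xs : List A) (k : ℕ) →
    coefficient (foldr _⊕_ [] (map t xs)) k ≈ ∑ xs (λ x → coefficient (t x) k)
  coefficient-∑ t []       k = refl
  coefficient-∑ t (x ∷ xs) k =
    trans (coefficient-⊕ (t x) _ k) (+-congˡ (coefficient-∑ t xs k))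

  -- The factor 1 - a x of a q-Pochhammer polynomial.
  linear : Carrier → Poly
  linear a = 1# ∷ - a ∷ []

  coefficient-linear-zero : (a : Carrier) (f : Poly) →
    coefficient (linear a ⊗ f) 0 ≈ coefficient f 0
  coefficient-linear-zero a f = begin
    coefficient (linear a ⊗ f) 0  ≈⟨ coefficient-⊕ (1# ⊙ f) _ 0 ⟩
    coefficient (1# ⊙ f) 0 + 0#   ≈⟨ +-identityʳ _ ⟩
    coefficient (1# ⊙ f) 0        ≈⟨ coefficient-⊙ 1# f 0 ⟩
    1# * coefficient f 0          ≈⟨ *-identityˡ _ ⟩
    coefficient f 0               ∎

  coefficient-linear-suc : (a : Carrier) (f : Poly) (k : ℕ) →
    coefficient (linear a ⊗ f) (suc k) ≈ coefficient f (suc k) - a * coefficient f k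
  coefficient-linear-suc a f k = begin
    coefficient (linear a ⊗ f) (suc k)
      ≈⟨ coefficient-⊕ (1# ⊙ f) _ (suc k) ⟩
    coefficient (1# ⊙ f) (suc k) + coefficient ((- a ⊙ f) ⊕ (0# ∷ [])) k
      ≈⟨ +-cong (coefficient-⊙ 1# f (suc k)) (coefficient-⊕ (- a ⊙ f) (0# ∷ []) k) ⟩
    1# * coefficient f (suc k) + (coefficient (- a ⊙ f) k + coefficient (0# ∷ []) k)
      ≈⟨ +-congˡ (+-cong (coefficient-⊙ (- a) f k) (nil k)) ⟩
    1# * coefficient f (suc k) + (- a * coefficient f k + 0#)
      ≈⟨ solve 3 (λ a x y → :1 :* x :+ (:- a :* y :+ con 0ℤ) := x :- a :* y) refl _ _ _ ⟩
    coefficient f (suc k) - a * coefficient f k ∎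
    where
    nil : ∀ k → coefficient (0# ∷ []) k ≈ 0#
    nil zero    = refl
    nil (suc _) = refl

  -- Equality of all coefficients.
  infix 4 _≋_
  _≋_ : Poly → Poly → Set _
  f ≋ g = ∀ k → coefficient f k ≈ coefficient g k

  linear-cong : (a : Carrier) (f g : Poly) → f ≋ g → linear a ⊗ f ≋ linear a ⊗ g
  linear-cong a f g f≋g zero    = begin
    coefficient (linear a ⊗ f) 0  ≈⟨ coefficient-linear-zero a f ⟩
    coefficient f 0               ≈⟨ f≋g 0 ⟩
    coefficient g 0               ≈⟨ coefficient-linear-zero a g ⟨
    coefficient (linear a ⊗ g) 0  ∎
  linear-cong a f g f≋g (suc k) = begin
    coefficient (linear a ⊗ f) (suc k)            ≈⟨ coefficient-linear-suc a f k ⟩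
    coefficient f (suc k) - a * coefficient f k
      ≈⟨ +-cong (f≋g (suc k)) (-‿cong (*-congˡ (f≋g k))) ⟩
    coefficient g (suc k) - a * coefficient g k   ≈⟨ coefficient-linear-suc a g k ⟨
    coefficient (linear a ⊗ g) (suc k)            ∎

  linear-comm : (a b : Carrier) (f : Poly) → linear a ⊗ (linear b ⊗ f) ≋ linear b ⊗ (linear a ⊗ f)
  linear-comm a b f zero          = trans (zero-zero a b) (sym (zero-zero b a))
    where
    zero-zero : ∀ a b → coefficient (linear a ⊗ (linear b ⊗ f)) 0 ≈ coefficient f 0
    zero-zero a b = trans (coefficient-linear-zero a (linear b ⊗ f)) (coefficient-linear-zero b f)
  linear-comm a b f (suc zero)    = begin
    _ ≈⟨ one a b ⟩
    _ ≈⟨ solve 4 (λ a b x y → x :- b :* y :- a :* y := x :- a :* y :- b :* y) refl a b _ _ ⟩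
    _ ≈⟨ one b a ⟨
    _ ∎
    where
    one : ∀ a b → coefficient (linear a ⊗ (linear b ⊗ f)) 1
                ≈ coefficient f 1 - b * coefficient f 0 - a * coefficient f 0
    one a b = trans (coefficient-linear-suc a (linear b ⊗ f) 0)
      (+-cong (coefficient-linear-suc b f 0) (-‿cong (*-congˡ (coefficient-linear-zero b f))))
  linear-comm a b f (suc (suc k)) = begin
    _ ≈⟨ two a b ⟩
    _ ≈⟨ solve 5 (λ a b x y z → x :- b :* y :- a :* (y :- b :* z)
                             := x :- a :* y :- b :* (y :- a :* z)) refl a b _ _ _ ⟩
    _ ≈⟨ two b a ⟨
    _ ∎
    where
    two : ∀ a b → coefficient (linear a ⊗ (linear b ⊗ f)) (suc (suc k))
                ≈ coefficient f (suc (suc k)) - b * coefficient f (suc k)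
                  - a * (coefficient f (suc k) - b * coefficient f k)
    two a b = trans (coefficient-linear-suc a (linear b ⊗ f) (suc k))
      (+-cong (coefficient-linear-suc b f (suc k)) (-‿cong (*-congˡ (coefficient-linear-suc b f k))))

  -- Coefficients of (x;q)_i

  -- The recursive definition peels off the factor i = 0; here the last factor is
  -- moved to the front past all the others.
  pochhammer-suc : (i : ℕ) → pochhammer (suc i) ≋ linear (q ^ i) ⊗ pochhammer i
  pochhammer-suc i k = begin
    coefficient (pochhammer (suc i)) k
      ≡⟨ cong (λ xs → coefficient (foldr step (1# ∷ []) xs) k) (upTo-∷ʳ i) ⟨
    coefficient (foldr step (1# ∷ []) (upTo i ∷ʳ i)) k
      ≡⟨ cong (λ f → coefficient f k) (foldr-∷ʳ step (1# ∷ []) i (upTo i)) ⟩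
    coefficient (foldr step (step i (1# ∷ [])) (upTo i)) k
      ≈⟨ outwards (upTo i) k ⟩
    coefficient (linear (q ^ i) ⊗ pochhammer i) k ∎
    where
    step : ℕ → Poly → Poly
    step j f = linear (q ^ j) ⊗ f
    outwards : (xs : List ℕ) →
      foldr step (step i (1# ∷ [])) xs ≋ step i (foldr step (1# ∷ []) xs)
    outwards []       k = refl
    outwards (j ∷ xs) k = trans
      (linear-cong (q ^ j) (foldr step (step i (1# ∷ [])) xs)
                           (step i (foldr step (1# ∷ []) xs)) (outwards xs) k)
      (linear-comm (q ^ j) (q ^ i) (foldr step (1# ∷ []) xs) k)

  -- The coefficient of x^k in (x;q)_i.
  poch : ℕ → ℕ → Carrier
  poch i k = coefficient (pochhammer i) k

  poch-0 : (i : ℕ) → poch i 0 ≈ 1#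
  poch-0 zero    = refl
  poch-0 (suc i) = trans (pochhammer-suc i 0)
    (trans (coefficient-linear-zero (q ^ i) (pochhammer i)) (poch-0 i))

  poch-suc : (i k : ℕ) → poch (suc i) (suc k) ≈ poch i (suc k) - q ^ i * poch i k
  poch-suc i k = trans (pochhammer-suc i (suc k)) (coefficient-linear-suc (q ^ i) (pochhammer i) k)

  poch-above : (i k : ℕ) → i < k → poch i k ≈ 0#
  poch-above zero    (suc k) _         = refl
  poch-above (suc i) (suc k) (s≤s i<k) = begin
    poch (suc i) (suc k)             ≈⟨ poch-suc i k ⟩
    poch i (suc k) - q ^ i * poch i k
      ≈⟨ +-cong (poch-above i (suc k) (ℕₚ.m<n⇒m<1+n i<k)) (-‿cong (*-congˡ (poch-above i k i<k))) ⟩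
    0# - q ^ i * 0#                  ≈⟨ solve 1 (λ x → con 0ℤ :- x :* con 0ℤ := con 0ℤ) refl _ ⟩
    0#                               ∎

  unit-poch : (i : ℕ) → Unit (poch i i)
  unit-poch zero    = 1# , *-identityˡ 1#
  unit-poch (suc i) = unit-resp (sym leading) (unit-neg (unit-* (unit-q^ (+ i)) (unit-poch i)))
    where
    leading : poch (suc i) (suc i) ≈ - (q ^ i * poch i i)
    leading = trans (poch-suc i i) (trans (+-congʳ (poch-above i (suc i) ℕₚ.≤-refl)) (+-identityˡ _))

  mutual
    -- Ratios of neighbouring coefficients of (x;q)_i, in which k, i or both
    -- increase by one, cleared of denominators.  The three are proved together by
    -- induction on i.
    poch-next-k : (i k : ℕ) → (1# - q ^ suc k) * poch i (suc k) ≈ (q ^ i - q ^ k) * poch i k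
    poch-next-k zero    zero    =
      solve 1 (λ x → (:1 :- x :* :1) :* con 0ℤ := (:1 :- :1) :* :1) refl q
    poch-next-k zero    (suc k) = trans (zeroʳ _) (sym (zeroʳ _))
    poch-next-k (suc i) k       = trans (poch-next-both i k) (sym (poch-next-i i k))

    poch-next-both : (i k : ℕ) →
      (1# - q ^ suc k) * poch (suc i) (suc k) ≈ q ^ k * (q ^ suc i - 1#) * poch i k
    poch-next-both i k = begin
      (1# - q ^ suc k) * poch (suc i) (suc k)
        ≈⟨ *-congˡ (poch-suc i k) ⟩
      (1# - q ^ suc k) * (poch i (suc k) - q ^ i * poch i k)
        ≈⟨ solve 4 (λ u x y z → u :* (x :- y :* z) := u :* x :- u :* y :* z) refl _ _ _ _ ⟩
      (1# - q ^ suc k) * poch i (suc k) - (1# - q ^ suc k) * q ^ i * poch i k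
        ≈⟨ +-congʳ (poch-next-k i k) ⟩
      (q ^ i - q ^ k) * poch i k - (1# - q ^ suc k) * q ^ i * poch i k
        ≈⟨ solve 4 (λ q s t x → (s :- t) :* x :- (:1 :- q :* t) :* s :* x
                             := t :* (q :* s :- :1) :* x) refl q (q ^ i) (q ^ k) _ ⟩
      q ^ k * (q ^ suc i - 1#) * poch i k ∎

    poch-next-i : (i k : ℕ) →
      (q ^ suc i - q ^ k) * poch (suc i) k ≈ q ^ k * (q ^ suc i - 1#) * poch i k
    poch-next-i i zero    = begin
      (q ^ suc i - 1#) * poch (suc i) 0  ≈⟨ *-congˡ (trans (poch-0 (suc i)) (sym (poch-0 i))) ⟩
      (q ^ suc i - 1#) * poch i 0        ≈⟨ *-congʳ (*-identityˡ _) ⟨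
      1# * (q ^ suc i - 1#) * poch i 0   ∎
    poch-next-i i (suc k) = begin
      (q ^ suc i - q ^ suc k) * poch (suc i) (suc k)
        ≈⟨ *-congˡ (poch-suc i k) ⟩
      (q ^ suc i - q ^ suc k) * (poch i (suc k) - q ^ i * poch i k)
        ≈⟨ solve 5 (λ q s t x y → (q :* s :- q :* t) :* (x :- s :* y)
                               := (q :* s :- q :* t) :* x :- q :* s :* ((s :- t) :* y))
                 refl q (q ^ i) (q ^ k) _ _ ⟩
      (q ^ suc i - q ^ suc k) * poch i (suc k) - q ^ suc i * ((q ^ i - q ^ k) * poch i k)
        ≈⟨ +-congˡ (-‿cong (*-congˡ (poch-next-k i k))) ⟨
      (q ^ suc i - q ^ suc k) * poch i (suc k)
        - q ^ suc i * ((1# - q ^ suc k) * poch i (suc k))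
        ≈⟨ solve 4 (λ q s t x → (q :* s :- q :* t) :* x :- q :* s :* ((:1 :- q :* t) :* x)
                             := q :* t :* (q :* s :- :1) :* x) refl q (q ^ i) (q ^ k) _ ⟩
      q ^ suc k * (q ^ suc i - 1#) * poch i (suc k) ∎

  -- Linear independence of the (x;q)_i

  -- The matrix c(i,k) is triangular with invertible diagonal, so the coefficients
  -- of a combination of the (x;q)_i are determined from the top downwards.
  poch-compare : (n : ℕ) (a b : ℕ → Carrier) →
    (∀ k → k < n → ∑ (upTo n) (λ i → a i * poch i k) ≈ ∑ (upTo n) (λ i → b i * poch i k)) →
    ∀ i → i < n → a i ≈ b i
  poch-compare (suc n) a b h i i<1+n = compare (ℕₚ.m≤n⇒m<n∨m≡n (ℕₚ.≤-pred i<1+n))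
    where
    lower : (f : ℕ → Carrier) → ∑ (upTo n) (λ i → f i * poch i n) ≈ 0#
    lower f = ∑-zero (upTo n) λ i∈ →
      trans (*-congˡ (poch-above _ n (∈-upTo⁻ i∈))) (zeroʳ _)
    top-term : (f : ℕ → Carrier) → ∑ (upTo (suc n)) (λ i → f i * poch i n) ≈ f n * poch n n
    top-term f = trans (∑-last n _) (trans (+-congʳ (lower f)) (+-identityˡ _))
    top : a n ≈ b n
    top = unit-cancelʳ (unit-poch n)
      (trans (sym (top-term a)) (trans (h n ℕₚ.≤-refl) (top-term b)))
    compare : i < n ⊎ i ≡ n → a i ≈ b i
    compare (inj₂ ≡.refl) = top
    compare (inj₁ i<n)    = poch-compare n a b (λ k k<n →
      let S = λ f → ∑ (upTo n) (λ i → f i * poch i k) in begin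
      S a                                    ≈⟨ solve 2 (λ x y → x := x :+ y :- y) refl _ _ ⟩
      S a + a n * poch n k - a n * poch n k  ≈⟨ +-congʳ (∑-last n _) ⟨
      -- The top coordinates agree, so their terms can be subtracted.
      _                                      ≈⟨ +-cong (h k (ℕₚ.m<n⇒m<1+n k<n))
                                                       (-‿cong (*-congʳ top)) ⟩
      _                                      ≈⟨ +-congʳ (∑-last n _) ⟩
      S b + b n * poch n k - b n * poch n k  ≈⟨ solve 2 (λ x y → x := x :+ y :- y) refl _ _ ⟨
      S b                                    ∎) i i<n

  -- Generating polynomials of the q-hit numbers

  -- The factor [m-i]! (-1)^i q^(mi - C(i,2)) of R_i in the definition of the
  -- q-hit numbers.
  weight : ℕ → ℕ → Carrier
  weight m i = factorial (m ∸ i) * (- 1#) ^ i * q^ (+ m *ᶻ + i -ᶻ + (i C 2))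

  unit-weight : (m i : ℕ) → Unit (weight m i)
  unit-weight m i = unit-* (unit-* (#⇒unit (factorial#0 (m ∸ i)))
                                   (unit-^ (unit-neg (1# , *-identityˡ 1#)) i))
                           (unit-q^ (+ m *ᶻ + i -ᶻ + (i C 2)))

  weight-suc : (m i : ℕ) → weight (suc m) (suc i) ≈ - (q ^ suc m * weight m i)
  weight-suc m i = begin
    factorial (m ∸ i) * (- 1# * (- 1#) ^ i) * q^ (+ suc m *ᶻ + suc i -ᶻ + (suc i C 2))
      ≈⟨ *-congˡ (q^-split (+ suc m) (+ m *ᶻ + i -ᶻ + (i C 2)) exponent) ⟩
    factorial (m ∸ i) * (- 1# * (- 1#) ^ i) * (q ^ suc m * q^ (+ m *ᶻ + i -ᶻ + (i C 2)))
      ≈⟨ solve 4 (λ f s u v → f :* (:- :1 :* s) :* (u :* v) := :- (u :* (f :* s :* v))) refl _ _ _ _ ⟩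
    - (q ^ suc m * weight m i) ∎
    where
    ring-step : ∀ m i C → (1ℤ +ᶻ m) *ᶻ (1ℤ +ᶻ i) -ᶻ (i +ᶻ C) ≡ 1ℤ +ᶻ m +ᶻ (m *ᶻ i -ᶻ C)
    ring-step = ℤ-Solver.solve-∀
    exponent : + suc m *ᶻ + suc i -ᶻ + (suc i C 2) ≡ + suc m +ᶻ (+ m *ᶻ + i -ᶻ + (i C 2))
    exponent = ≡.trans (cong (λ x → + suc m *ᶻ + suc i -ᶻ + x) (choose-two i))
                       (ring-step (+ m) (+ i) (+ (i C 2)))

  weight-suc-board : (m i : ℕ) → i ≤ m →
    weight (suc m) i ≈ [ + suc m -ᶻ + i ]q * q ^ i * weight m i
  weight-suc-board m i i≤m = begin
    factorial (suc m ∸ i) * (- 1#) ^ i * q^ (+ suc m *ᶻ + i -ᶻ + (i C 2))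
      ≈⟨ *-cong (*-congʳ (reflexive factorial-step)) (q^-split (+ i) (+ m *ᶻ + i -ᶻ + (i C 2)) exponent) ⟩
    [ + suc m -ᶻ + i ]q * factorial (m ∸ i) * (- 1#) ^ i
      * (q ^ i * q^ (+ m *ᶻ + i -ᶻ + (i C 2)))
      ≈⟨ solve 5 (λ b f s u v → b :* f :* s :* (u :* v) := b :* u :* (f :* s :* v)) refl _ _ _ _ _ ⟩
    [ + suc m -ᶻ + i ]q * q ^ i * weight m i ∎
    where
    ring-step : ∀ m i C → (1ℤ +ᶻ m) *ᶻ i -ᶻ C ≡ i +ᶻ (m *ᶻ i -ᶻ C)
    ring-step = ℤ-Solver.solve-∀
    exponent : + suc m *ᶻ + i -ᶻ + (i C 2) ≡ + i +ᶻ (+ m *ᶻ + i -ᶻ + (i C 2))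
    exponent = ring-step (+ m) (+ i) (+ (i C 2))
    factorial-step : factorial (suc m ∸ i) ≡ [ + suc m -ᶻ + i ]q * factorial (m ∸ i)
    factorial-step = ≡.trans (cong factorial (ℕₚ.+-∸-assoc 1 i≤m))
      (cong (λ z → [ z ]q * factorial (m ∸ i)) (≡.sym (≡.trans (ℤₚ.m-n≡m⊖n (suc m) i)
        (≡.trans (ℤₚ.⊖-≥ (ℕₚ.m≤n⇒m≤1+n i≤m)) (cong +_ (ℕₚ.+-∸-assoc 1 i≤m))))))

  -- The prefactor q^s / [m-n]! of the q-hit numbers, with an arbitrary exponent s
  -- in place of -|μ|.
  scale : ℕ → ℕ → ℤ → Carrier
  scale m n s = q^ s * factorial⁻¹ (m ∸ n)

  unit-scale : (m n : ℕ) (s : ℤ) → Unit (scale m n s)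
  unit-scale m n s = unit-* (unit-q^ s) (#⇒unit (inverse#0 _ (factorial#0 (m ∸ n))))

  scale-+ : (m n : ℕ) (s t : ℤ) → scale m n (s +ᶻ t) ≈ q^ s * scale m n t
  scale-+ m n s t = trans (*-congʳ (q^-+ s t)) (*-assoc _ _ _)

  -- The coefficient of x^k in the sum of the a_i (x;q)_i over i < n.
  expand : ℕ → (ℕ → Carrier) → ℕ → Carrier
  expand n a k = ∑ (upTo n) (λ i → a i * poch i k)

  hit-expand : (m n : ℕ) (μ : List ℕ) (k : ℕ) →
    hit k m n μ ≈ scale m n (-ᶻ (+ size μ)) * expand (suc n) (λ i → rook i μ * weight m i) k
  hit-expand m n μ k = begin
    hit k m n μ
      ≈⟨ coefficient-⊙ _ (foldr _⊕_ [] (map (hitTerm m μ) [ 0 ⋯ n ])) k ⟩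
    s * coefficient (foldr _⊕_ [] (map (hitTerm m μ) [ 0 ⋯ n ])) k
      ≈⟨ *-congˡ (coefficient-∑ (hitTerm m μ) [ 0 ⋯ n ] k) ⟩
    s * ∑ [ 0 ⋯ n ] (λ i → coefficient (hitTerm m μ i) k)
      ≡⟨ cong (λ xs → s * ∑ xs (λ i → coefficient (hitTerm m μ i) k)) (map-id (upTo (suc n))) ⟩
    s * ∑ (upTo (suc n)) (λ i → coefficient (hitTerm m μ i) k)
      ≈⟨ *-congˡ (∑-cong (upTo (suc n)) (λ {i} _ → trans (coefficient-⊙ _ (pochhammer i) k)
           (*-congʳ (solve 4 (λ a b c d → a :* b :* c :* d := a :* (b :* c :* d)) refl _ _ _ _)))) ⟩
    s * expand (suc n) (λ i → rook i μ * weight m i) k ∎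
    where
    s : Carrier
    s = scale m n (-ᶻ (+ size μ))

  -- A sum of q-hit numbers over a family of boards ν_x.  If the exponents e_x and f_x
  -- satisfy e_x - |ν_x| = s + f_x, the sum has the same form as a single
  -- q-hit number, with R_i replaced by the sum of the q^(f_x) R_i(ν_x).
  hit-sum : {A : Set} (xs : List A) (ν : A → List ℕ) (e f : A → ℤ) (s : ℤ) (m n k : ℕ) →
    (∀ {x} → x ∈ xs → e x -ᶻ + size (ν x) ≡ s +ᶻ f x) →
    ∑ xs (λ x → q^ (e x) * hit k m n (ν x))
      ≈ scale m n s * expand (suc n) (λ i → ∑ xs (λ x → q^ (f x) * rook i (ν x)) * weight m i) k
  hit-sum xs ν e f s m n k h = begin
    ∑ xs (λ x → q^ (e x) * hit k m n (ν x))
      ≈⟨ ∑-cong xs each ⟩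
    ∑ xs (λ x → scale m n s * ∑ (upTo (suc n)) (λ i → q^ (f x) * rook i (ν x) * weight m i * poch i k))
      ≈⟨ ∑-*ˡ (scale m n s) xs _ ⟨
    scale m n s * ∑ xs (λ x → ∑ (upTo (suc n)) (λ i → q^ (f x) * rook i (ν x) * weight m i * poch i k))
      ≈⟨ *-congˡ (∑-swap xs (upTo (suc n)) _) ⟩
    scale m n s * ∑ (upTo (suc n)) (λ i → ∑ xs (λ x → q^ (f x) * rook i (ν x) * weight m i * poch i k))
      ≈⟨ *-congˡ (∑-cong (upTo (suc n)) (λ {i} _ →
           trans (*-congʳ (∑-*ʳ xs _ (weight m i))) (∑-*ʳ xs _ (poch i k)))) ⟨
    _ ∎
    where
    each : ∀ {x} → x ∈ xs → q^ (e x) * hit k m n (ν x)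
      ≈ scale m n s * ∑ (upTo (suc n)) (λ i → q^ (f x) * rook i (ν x) * weight m i * poch i k)
    each {x} x∈ = begin
      q^ (e x) * hit k m n (ν x)
        ≈⟨ *-congˡ (hit-expand m n (ν x) k) ⟩
      q^ (e x) * (scale m n (-ᶻ (+ size (ν x))) * R)
        ≈⟨ *-assoc _ _ _ ⟨
      q^ (e x) * scale m n (-ᶻ (+ size (ν x))) * R
        ≈⟨ *-congʳ (scale-+ m n (e x) (-ᶻ (+ size (ν x)))) ⟨
      scale m n (e x -ᶻ + size (ν x)) * R
        ≡⟨ cong (λ z → scale m n z * R) (≡.trans (h x∈) (ℤₚ.+-comm s (f x))) ⟩
      scale m n (f x +ᶻ s) * R
        ≈⟨ *-congʳ (scale-+ m n (f x) s) ⟩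
      q^ (f x) * scale m n s * R
        ≈⟨ solve 3 (λ u v w → u :* v :* w := v :* (u :* w)) refl _ _ _ ⟩
      scale m n s * (q^ (f x) * R)
        ≈⟨ *-congˡ (∑-*ˡ _ (upTo (suc n)) _) ⟩
      scale m n s * ∑ (upTo (suc n)) (λ i → q^ (f x) * (rook i (ν x) * weight m i * poch i k))
        ≈⟨ *-congˡ (∑-cong (upTo (suc n)) (λ _ →
             solve 4 (λ a b c d → a :* (b :* c :* d) := a :* b :* c :* d) refl _ _ _ _)) ⟩
      _ ∎
      where
      R : Carrier
      R = expand (suc n) (λ i → rook i (ν x) * weight m i) k

  expand-cong : (n : ℕ) {a b : ℕ → Carrier} (k : ℕ) → (∀ i → i < n → a i ≈ b i) →
    expand n a k ≈ expand n b k
  expand-cong n k h = ∑-cong (upTo n) (λ i∈ → *-congʳ (h _ (∈-upTo⁻ i∈)))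

  -- The principle behind all three equivalences: two expansions agree coefficientwise
  -- if and only if their coordinates in the (x;q)_i agree, whatever invertible
  -- factors u_k and w_i are attached.
  expand⇔ : (n : ℕ) {L R : ℕ → Carrier} (u w : ℕ → Carrier) {a b : ℕ → Carrier} →
    (∀ k → Unit (u k)) → (∀ i → Unit (w i)) →
    (∀ k → k < n → L k ≈ u k * expand n (λ i → a i * w i) k) →
    (∀ k → k < n → R k ≈ u k * expand n (λ i → b i * w i) k) →
    (∀ k → k < n → L k ≈ R k) ⇔ (∀ i → i < n → a i ≈ b i)
  expand⇔ n {L} {R} u w {a} {b} unit-u unit-w L≈ R≈ = mk⇔
    (λ L≈R i i<n → unit-cancelʳ (unit-w i) (poch-compare n (λ i → a i * w i) (λ i → b i * w i)
      (λ k k<n → unit-cancelˡ (unit-u k)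
        (trans (sym (L≈ k k<n)) (trans (L≈R k k<n) (R≈ k k<n)))) i i<n))
    (λ a≈b k k<n → trans (L≈ k k<n)
      (trans (*-congˡ (expand-cong n k (λ i i<n → *-congʳ (a≈b i i<n)))) (sym (R≈ k k<n))))

  rook-zero : (k : ℕ) (μ : List ℕ) → length μ < k → rook k μ ≈ 0#
  rook-zero k μ l<k = reflexive (cong (λ ps → ∑ ps (λ p → q ^ inv μ p)) (placements-none k μ l<k))

  scale-step : {m n d : ℕ} {z : ℤ} (s : ℤ) → m ∸ n ≡ suc d → z ≡ + suc d →
    [ z ]q * scale m n s ≈ q^ s * factorial⁻¹ d
  scale-step {m} {n} {d} s m∸n≡ ≡.refl = begin
    [ + suc d ]q * (q^ s * factorial⁻¹ (m ∸ n))
      ≡⟨ cong (λ e → [ + suc d ]q * (q^ s * factorial⁻¹ e)) m∸n≡ ⟩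
    [ + suc d ]q * (q^ s * factorial⁻¹ (suc d))
      ≈⟨ solve 3 (λ x y z → x :* (y :* z) := y :* (x :* z)) refl _ _ _ ⟩
    q^ s * ([ + suc d ]q * factorial⁻¹ (suc d))
      ≈⟨ *-congˡ (bracket-factorial⁻¹ d) ⟩
    q^ s * factorial⁻¹ d ∎

  -- Columns

  -- The coefficients of (x;q)_{i-1}.  The value 0 at i = 0 is a convention: it is
  -- only ever multiplied by a factor that vanishes there.
  poch-pred : ℕ → ℕ → Carrier
  poch-pred zero    k = 0#
  poch-pred (suc i) k = poch i k

  -- The coefficient of x^k in q^i (x/q;q)_i = (x;q)_i + (q^i - 1) (x;q)_{i-1}.
  poch-rescale : (i k : ℕ) →
    q^ (-ᶻ (+ k)) * (q ^ i * poch i k) ≈ poch i k + (q ^ i - 1#) * poch-pred i k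
  poch-rescale zero    zero    =
    solve 0 (:1 :* (:1 :* :1) := :1 :+ (:1 :- :1) :* con 0ℤ) refl
  poch-rescale zero    (suc k) =
    solve 1 (λ x → x :* (:1 :* con 0ℤ) := con 0ℤ :+ (:1 :- :1) :* con 0ℤ) refl _
  poch-rescale (suc i) k       = begin
    r * (q ^ suc i * X)
      ≈⟨ solve 4 (λ r s t x → r :* (s :* x) := r :* ((s :- t) :* x :+ t :* x)) refl r (q ^ suc i) (q ^ k) X ⟩
    r * ((q ^ suc i - q ^ k) * X + q ^ k * X)
      ≈⟨ *-congˡ (+-congʳ (poch-next-i i k)) ⟩
    r * (q ^ k * (q ^ suc i - 1#) * poch i k + q ^ k * X)
      ≈⟨ solve 5 (λ r s t x y → r :* (t :* (s :- :1) :* y :+ t :* x) := r :* t :* (x :+ (s :- :1) :* y))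
                 refl r (q ^ suc i) (q ^ k) X (poch i k) ⟩
    r * q ^ k * (X + (q ^ suc i - 1#) * poch i k)
      ≈⟨ trans (*-congʳ (q^-neg (+ k))) (*-identityˡ _) ⟩
    X + (q ^ suc i - 1#) * poch i k ∎
    where
    r X : Carrier
    r = q^ (-ᶻ (+ k))
    X = poch (suc i) k

  -- The substitution x/q in a combination of the (x;q)_i.  Each i contributes to
  -- the indices i and i - 1, so ρ_i and ρ_{i+1} meet in the coordinate of (x;q)_i;
  -- at i = n the second of them is ρ_{n+1} = 0.
  column-expand : (m n : ℕ) (ρ : ℕ → Carrier) (k : ℕ) → n ≤ m → ρ (suc n) ≈ 0# →
    q^ (-ᶻ (+ k)) * expand (suc n) (λ i → ρ i * weight (suc m) i) k
      ≈ expand (suc n) (λ i → (ρ i * [ + suc m -ᶻ + i ]q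
                               - ρ (i ℕ.+ 1) * (q^ (+ suc m) - q^ (+ suc m -ᶻ + i -ᶻ 1ℤ)))
                              * weight m i) k
  column-expand m n ρ k n≤m ρ≈0 = begin
    r * expand (suc n) (λ i → ρ i * weight (suc m) i) k
      ≈⟨ ∑-*ˡ r (upTo (suc n)) _ ⟩
    ∑ (upTo (suc n)) (λ i → r * (ρ i * weight (suc m) i * poch i k))
      ≈⟨ ∑-cong (upTo (suc n)) (λ i∈ → term _ (ℕₚ.≤-pred (∈-upTo⁻ i∈))) ⟩
    ∑ (upTo (suc n)) (λ i → x i * poch i k + y i * poch-pred i k)
      ≈⟨ ∑-+ (upTo (suc n)) _ _ ⟩
    ∑ (upTo (suc n)) (λ i → x i * poch i k) + ∑ (upTo (suc n)) (λ i → y i * poch-pred i k)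
      ≈⟨ +-congˡ (∑-shift (suc n) _ (zeroʳ _) y-last) ⟩
    ∑ (upTo (suc n)) (λ i → x i * poch i k) + ∑ (upTo (suc n)) (λ i → y (suc i) * poch i k)
      ≈⟨ ∑-+ (upTo (suc n)) _ _ ⟨
    ∑ (upTo (suc n)) (λ i → x i * poch i k + y (suc i) * poch i k)
      ≈⟨ ∑-cong (upTo (suc n)) (λ {i} _ → trans (sym (distribʳ _ _ _)) (*-congʳ (collect i))) ⟩
    _ ∎
    where
    r : Carrier
    r = q^ (-ᶻ (+ k))
    x y : ℕ → Carrier
    x i = ρ i * [ + suc m -ᶻ + i ]q * weight m i
    y i = ρ i * weight (suc m) i * (1# - q^ (-ᶻ (+ i)))

    term : ∀ i → i ≤ n →
      r * (ρ i * weight (suc m) i * poch i k) ≈ x i * poch i k + y i * poch-pred i k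
    term i i≤n = begin
      r * (ρ i * weight (suc m) i * poch i k)
        ≈⟨ *-congˡ (*-congʳ (*-congˡ weight≈)) ⟩
      r * (ρ i * (b * q ^ i * w) * poch i k)
        ≈⟨ solve 6 (λ r p b s w c → r :* (p :* (b :* s :* w) :* c) := p :* b :* w :* (r :* (s :* c)))
                   refl r (ρ i) b (q ^ i) w (poch i k) ⟩
      x i * (r * (q ^ i * poch i k))
        ≈⟨ *-congˡ (poch-rescale i k) ⟩
      x i * (poch i k + (q ^ i - 1#) * poch-pred i k)
        ≈⟨ *-congˡ (+-congˡ (*-congʳ (+-congˡ (-‿cong (q^-neg (+ i)))))) ⟨
      x i * (poch i k + (q ^ i - q^ (-ᶻ (+ i)) * q ^ i) * poch-pred i k)
        ≈⟨ solve 7 (λ p b w c s t d → p :* b :* w :* (c :+ (s :- t :* s) :* d)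
                     := p :* b :* w :* c :+ p :* (b :* s :* w) :* (:1 :- t) :* d)
                   refl (ρ i) b w (poch i k) (q ^ i) (q^ (-ᶻ (+ i))) (poch-pred i k) ⟩
      x i * poch i k + ρ i * (b * q ^ i * w) * (1# - q^ (-ᶻ (+ i))) * poch-pred i k
        ≈⟨ +-congˡ (*-congʳ (*-congʳ (*-congˡ weight≈))) ⟨
      x i * poch i k + y i * poch-pred i k ∎
      where
      b w : Carrier
      b = [ + suc m -ᶻ + i ]q
      w = weight m i
      weight≈ : weight (suc m) i ≈ b * q ^ i * w
      weight≈ = weight-suc-board m i (ℕₚ.≤-trans i≤n n≤m)

    y-last : y (suc n) * poch n k ≈ 0#
    y-last = trans (*-congʳ (*-congʳ (*-congʳ ρ≈0)))
      (solve 3 (λ a b c → con 0ℤ :* a :* b :* c := con 0ℤ) refl _ _ _)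

    exponent : (i : ℕ) → + suc m -ᶻ + i -ᶻ 1ℤ ≡ + suc m +ᶻ -ᶻ (+ suc i)
    exponent i = identity (+ suc m) (+ i)
      where
      identity : ∀ m i → m -ᶻ i -ᶻ 1ℤ ≡ m +ᶻ -ᶻ (1ℤ +ᶻ i)
      identity = ℤ-Solver.solve-∀

    collect : ∀ i → x i + y (suc i)
      ≈ (ρ i * [ + suc m -ᶻ + i ]q - ρ (i ℕ.+ 1) * (q^ (+ suc m) - q^ (+ suc m -ᶻ + i -ᶻ 1ℤ)))
        * weight m i
    collect i = begin
      x i + y (suc i)
        ≈⟨ +-congˡ (*-congʳ (*-congˡ (weight-suc m i))) ⟩
      x i + ρ (suc i) * - (q ^ suc m * weight m i) * (1# - q^ (-ᶻ (+ suc i)))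
        ≈⟨ solve 6 (λ p b w p′ s t → p :* b :* w :+ p′ :* :- (s :* w) :* (:1 :- t)
                     := (p :* b :- p′ :* (s :- s :* t)) :* w) refl _ _ _ _ _ _ ⟩
      (ρ i * [ + suc m -ᶻ + i ]q - ρ (suc i) * (q ^ suc m - q ^ suc m * q^ (-ᶻ (+ suc i))))
        * weight m i
        ≈⟨ *-congʳ (+-congˡ (-‿cong (*-cong (reflexive (cong ρ (ℕₚ.+-comm i 1)))
             (+-congˡ (-‿cong (q^-split (+ suc m) (-ᶻ (+ suc i)) (exponent i))))))) ⟨
      _ ∎

  column⇔ : (m n : ℕ) (μ : List ℕ) → InBoard n (suc m) μ → n ≤ m →
    Identities.HitColumn (suc m) n μ ⇔ Identities.RookColumn (suc m) n μ
  column⇔ m n μ board n≤m = mk⇔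
    (λ H k k≤n → to (λ k k<1+n → H k (ℕₚ.≤-pred k<1+n)) k (s≤s k≤n))
    (λ R k k≤n → from (λ k k<1+n → R k (ℕₚ.≤-pred k<1+n)) k (s≤s k≤n))
    where
    open InBoard board
    s : ℤ
    s = + n -ᶻ + size μ

    exponent : ∀ {j} → j ∈ [ 1 ⋯ suc m ] →
      + suc m +ᶻ + n -ᶻ + j -ᶻ + column μ j -ᶻ + size (removeColumn j μ) ≡ s +ᶻ (+ suc m -ᶻ + j)
    exponent {j} j∈ = ≡.trans
      (identity (+ suc m) (+ n) (+ j) (+ column μ j) (+ size (removeColumn j μ)))
      (cong (λ z → + n -ᶻ + z +ᶻ (+ suc m -ᶻ + j)) (size-removeColumn j μ (proj₁ (∈-range⁻ j∈))))
      where
      identity : ∀ m n j a b → m +ᶻ n -ᶻ j -ᶻ a -ᶻ b ≡ n -ᶻ (b +ᶻ a) +ᶻ (m -ᶻ j)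
      identity = ℤ-Solver.solve-∀

    right : ∀ k → [ + suc m -ᶻ + n ]q * hit k (suc m) n μ * q^ (+ n -ᶻ + k)
      ≈ scale m n s * expand (suc n) (λ i → (rook i μ * [ + suc m -ᶻ + i ]q
          - rook (i ℕ.+ 1) μ * (q^ (+ suc m) - q^ (+ suc m -ᶻ + i -ᶻ 1ℤ))) * weight m i) k
    right k = begin
      b * hit k (suc m) n μ * q^ (+ n -ᶻ + k)
        ≈⟨ *-cong (*-congˡ (hit-expand (suc m) n μ k)) (q^-+ (+ n) (-ᶻ (+ k))) ⟩
      b * (scale (suc m) n (-ᶻ (+ size μ)) * E) * (q ^ n * q^ (-ᶻ (+ k)))
        ≈⟨ solve 5 (λ a b c d e → a :* (b :* c) :* (d :* e) := d :* (a :* b) :* (e :* c)) refl _ _ _ _ _ ⟩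
      q ^ n * (b * scale (suc m) n (-ᶻ (+ size μ))) * (q^ (-ᶻ (+ k)) * E)
        ≈⟨ *-cong (*-congˡ (scale-step {suc m} {n} (-ᶻ (+ size μ)) (ℕₚ.+-∸-assoc 1 n≤m) difference))
                  (column-expand m n (λ i → rook i μ) k n≤m (rook-zero (suc n) μ (s≤s (ℕₚ.≤-reflexive rows)))) ⟩
      q ^ n * scale m n (-ᶻ (+ size μ)) * _
        ≈⟨ *-congʳ (scale-+ m n (+ n) (-ᶻ (+ size μ))) ⟨
      _ ∎
      where
      b E : Carrier
      b = [ + suc m -ᶻ + n ]q
      E = expand (suc n) (λ i → rook i μ * weight (suc m) i) k
      difference : + suc m -ᶻ + n ≡ + suc (m ∸ n)
      difference = ≡.trans (≡.sym (pos-∸ (ℕₚ.m≤n⇒m≤1+n n≤m))) (cong +_ (ℕₚ.+-∸-assoc 1 n≤m))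

    open Equivalence (expand⇔ (suc n) (λ _ → scale m n s) (weight m)
      (λ _ → unit-scale m n s) (unit-weight m)
      (λ k _ → hit-sum [ 1 ⋯ suc m ] (λ j → removeColumn j μ)
        (λ j → + suc m +ᶻ + n -ᶻ + j -ᶻ + column μ j) (λ j → + suc m -ᶻ + j) s m n k exponent)
      (λ k _ → right k))
      using (to; from)

  -- Rows

  -- The coefficient form of ([n] - [i]) (x;q)_i.
  row-poch : (n i k : ℕ) →
    poch i k * (q ^ k * [ + n -ᶻ + k ]q) + poch i (suc k) * [ + suc k ]q
      ≈ ([ + n ]q - [ + i ]q) * poch i k
  row-poch n i k = begin
    poch i k * (q ^ k * ((1# - q^ (+ n -ᶻ + k)) * ι)) + poch i (suc k) * ((1# - q ^ suc k) * ι)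
      ≈⟨ solve 6 (λ x y t v w ι → x :* (t :* ((:1 :- v) :* ι)) :+ y :* (w :* ι)
                   := ι :* (x :* (t :- v :* t) :+ w :* y))
                 refl (poch i k) (poch i (suc k)) (q ^ k) (q^ (+ n -ᶻ + k)) (1# - q ^ suc k) ι ⟩
    ι * (poch i k * (q ^ k - q^ (+ n -ᶻ + k) * q ^ k) + (1# - q ^ suc k) * poch i (suc k))
      ≈⟨ *-congˡ (+-cong (*-congˡ (+-congˡ (-‿cong (sym power)))) (poch-next-k i k)) ⟩
    ι * (poch i k * (q ^ k - q ^ n) + (q ^ i - q ^ k) * poch i k)
      ≈⟨ solve 5 (λ x t n i ι → ι :* (x :* (t :- n) :+ (i :- t) :* x)
                   := ((:1 :- n) :* ι :- (:1 :- i) :* ι) :* x)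
                 refl (poch i k) (q ^ k) (q ^ n) (q ^ i) ι ⟩
    ([ + n ]q - [ + i ]q) * poch i k ∎
    where
    ι : Carrier
    ι = inverse (1# - q) 1-q#0
    identity : ∀ n k → n ≡ n -ᶻ k +ᶻ k
    identity = ℤ-Solver.solve-∀
    power : q ^ n ≈ q^ (+ n -ᶻ + k) * q ^ k
    power = q^-split (+ n -ᶻ + k) (+ k) (identity (+ n) (+ k))

  row-expand : (n : ℕ) (a : ℕ → Carrier) (k : ℕ) →
    expand (suc n) a k * (q ^ k * [ + n -ᶻ + k ]q) + expand (suc n) a (suc k) * [ + suc k ]q
      ≈ expand n (λ i → ([ + n ]q - [ + i ]q) * a i) k
  row-expand n a k = begin
    expand (suc n) a k * u + expand (suc n) a (suc k) * v
      ≈⟨ +-cong (∑-*ʳ (upTo (suc n)) _ u) (∑-*ʳ (upTo (suc n)) _ v) ⟩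
    _ ≈⟨ ∑-+ (upTo (suc n)) _ _ ⟨
    ∑ (upTo (suc n)) (λ i → a i * poch i k * u + a i * poch i (suc k) * v)
      ≈⟨ ∑-cong (upTo (suc n)) (λ {i} _ → term i) ⟩
    expand (suc n) (λ i → ([ + n ]q - [ + i ]q) * a i) k
      ≈⟨ ∑-last n _ ⟩
    expand n (λ i → ([ + n ]q - [ + i ]q) * a i) k + ([ + n ]q - [ + n ]q) * a n * poch n k
      ≈⟨ solve 4 (λ x b y z → x :+ (b :- b) :* y :* z := x) refl _ _ _ _ ⟩
    expand n (λ i → ([ + n ]q - [ + i ]q) * a i) k ∎
    where
    u v : Carrier
    u = q ^ k * [ + n -ᶻ + k ]q
    v = [ + suc k ]q
    term : ∀ i → a i * poch i k * u + a i * poch i (suc k) * v ≈ ([ + n ]q - [ + i ]q) * a i * poch i k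
    term i = begin
      a i * poch i k * u + a i * poch i (suc k) * v
        ≈⟨ solve 5 (λ a x y u v → a :* x :* u :+ a :* y :* v := a :* (x :* u :+ y :* v)) refl _ _ _ _ _ ⟩
      a i * (poch i k * u + poch i (suc k) * v)
        ≈⟨ *-congˡ (row-poch n i k) ⟩
      a i * (([ + n ]q - [ + i ]q) * poch i k)
        ≈⟨ solve 3 (λ x y z → x :* (y :* z) := y :* x :* z) refl _ _ _ ⟩
      ([ + n ]q - [ + i ]q) * a i * poch i k ∎

  -- The columns m + 1, ..., m + n lie outside the board and have length 0; the
  -- index i there stands for the row r = m + n + 1 - i.
  row-reindex : (m n : ℕ) (μ : List ℕ) (h : List ℕ → Carrier) → InBoard n m μ →
    ∑ [ m ℕ.+ 1 ⋯ m ℕ.+ n ] (λ i →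
        q^ (+ m +ᶻ + n -ᶻ + i -ᶻ + column μ i) * h (removeRow (m ℕ.+ n ℕ.+ 1 ∸ i) μ))
      ≈ ∑ [ 1 ⋯ n ] (λ r → q^ (+ r -ᶻ 1ℤ) * h (removeRow r μ))
  row-reindex m n μ h board = begin
    ∑ [ m ℕ.+ 1 ⋯ m ℕ.+ n ] F
      ≡⟨ ∑-map (m ℕ.+ 1 ℕ.+_) (upTo (suc (m ℕ.+ n) ∸ (m ℕ.+ 1))) F ⟩
    ∑ (upTo (suc (m ℕ.+ n) ∸ (m ℕ.+ 1))) (λ t → F (m ℕ.+ 1 ℕ.+ t))
      ≡⟨ cong (λ l → ∑ (upTo l) (λ t → F (m ℕ.+ 1 ℕ.+ t))) range-length ⟩
    ∑ (upTo n) (λ t → F (m ℕ.+ 1 ℕ.+ t))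
      ≈⟨ ∑-cong (upTo n) (λ t∈ → reflexive (term _ (∈-upTo⁻ t∈))) ⟩
    ∑ (upTo n) (λ t → G (n ∸ t))
      ≈⟨ ∑-reverse n G ⟩
    ∑ [ 1 ⋯ n ] G ∎
    where
    open InBoard board
    F G : ℕ → Carrier
    F i = q^ (+ m +ᶻ + n -ᶻ + i -ᶻ + column μ i) * h (removeRow (m ℕ.+ n ℕ.+ 1 ∸ i) μ)
    G r = q^ (+ r -ᶻ 1ℤ) * h (removeRow r μ)

    commute : m ℕ.+ n ℕ.+ 1 ≡ m ℕ.+ 1 ℕ.+ n
    commute = ≡.trans (ℕₚ.+-assoc m n 1)
      (≡.trans (cong (m ℕ.+_) (ℕₚ.+-comm n 1)) (≡.sym (ℕₚ.+-assoc m 1 n)))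
    range-length : suc (m ℕ.+ n) ∸ (m ℕ.+ 1) ≡ n
    range-length = ≡.trans
      (cong (_∸ (m ℕ.+ 1)) (≡.trans (ℕₚ.+-comm 1 (m ℕ.+ n)) commute)) (ℕₚ.m+n∸m≡n (m ℕ.+ 1) n)

    identity : ∀ m n t → m +ᶻ n -ᶻ (m +ᶻ 1ℤ +ᶻ t) -ᶻ 0ℤ ≡ n -ᶻ t -ᶻ 1ℤ
    identity = ℤ-Solver.solve-∀

    term : ∀ t → t < n → F (m ℕ.+ 1 ℕ.+ t) ≡ G (n ∸ t)
    term t t<n = cong₂ (λ e r → q^ e * h (removeRow r μ)) exponent row
      where
      row : m ℕ.+ n ℕ.+ 1 ∸ (m ℕ.+ 1 ℕ.+ t) ≡ n ∸ t
      row = ≡.trans (cong (_∸ (m ℕ.+ 1 ℕ.+ t)) commute) (ℕₚ.[m+n]∸[m+o]≡n∸o (m ℕ.+ 1) n t)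
      m<i : m < m ℕ.+ 1 ℕ.+ t
      m<i = ℕₚ.<-≤-trans (ℕₚ.m<m+n m (s≤s z≤n)) (ℕₚ.m≤m+n (m ℕ.+ 1) t)
      exponent : + m +ᶻ + n -ᶻ + (m ℕ.+ 1 ℕ.+ t) -ᶻ + column μ (m ℕ.+ 1 ℕ.+ t) ≡ + (n ∸ t) -ᶻ 1ℤ
      exponent = ≡.trans
        (cong (λ x → + m +ᶻ + n -ᶻ + (m ℕ.+ 1 ℕ.+ t) -ᶻ + x)
              (column-outside μ (m ℕ.+ 1 ℕ.+ t) bounded m<i))
        (≡.trans (identity (+ m) (+ n) (+ t)) (cong (_-ᶻ 1ℤ) (≡.sym (pos-∸ (ℕₚ.<⇒≤ t<n)))))

  row⇔ : (m n : ℕ) (μ : List ℕ) → InBoard (suc n) m μ → suc n ≤ m →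
    Identities.HitRow m (suc n) μ ⇔ Identities.RookRow m (suc n) μ
  row⇔ m n μ board n<m = mk⇔
    (λ H k k≤1+n → all-k (to H) k (ℕₚ.m≤n⇒m<n∨m≡n k≤1+n))
    (λ R → from (λ k k<1+n → R k (ℕₚ.<⇒≤ k<1+n)))
    where
    open InBoard board
    N : ℕ
    N = suc n
    s : ℤ
    s = -ᶻ (+ size μ)
    A B : ℕ → Carrier
    A k = ∑ [ 1 ⋯ N ] (λ i → q^ (+ i -ᶻ 1ℤ +ᶻ + part μ i) * rook k (removeRow i μ))
    B k = ([ + N ]q - [ + k ]q) * rook k μ

    in-rows : ∀ {r} → r ∈ [ 1 ⋯ N ] → 1 ≤ r × r ≤ length μ
    in-rows r∈ = proj₁ (∈-range⁻ r∈) , ℕₚ.≤-trans (proj₂ (∈-range⁻ r∈)) (ℕₚ.≤-reflexive (≡.sym rows))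

    exponent : ∀ {r} → r ∈ [ 1 ⋯ N ] →
      + r -ᶻ 1ℤ -ᶻ + size (removeRow r μ) ≡ s +ᶻ (+ r -ᶻ 1ℤ +ᶻ + part μ r)
    exponent {r} r∈ = ≡.trans
      (identity (+ r -ᶻ 1ℤ) (+ size (removeRow r μ)) (+ part μ r))
      (cong (λ z → -ᶻ (+ z) +ᶻ (+ r -ᶻ 1ℤ +ᶻ + part μ r))
            (size-removeRow r μ (proj₁ (in-rows r∈)) (proj₂ (in-rows r∈))))
      where
      identity : ∀ r a b → r -ᶻ a ≡ -ᶻ (a +ᶻ b) +ᶻ (r +ᶻ b)
      identity = ℤ-Solver.solve-∀

    m∸n≡ : m ∸ n ≡ suc (m ∸ N)
    m∸n≡ = ℕₚ.+-∸-assoc 1 n<m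
    difference : + m -ᶻ + N +ᶻ 1ℤ ≡ + suc (m ∸ N)
    difference = ≡.trans (cong (_+ᶻ 1ℤ) (≡.sym (pos-∸ n<m))) (ℤₚ.+-comm (+ (m ∸ N)) 1ℤ)

    left : ∀ k → [ + m -ᶻ + N +ᶻ 1ℤ ]q *
        ∑ [ m ℕ.+ 1 ⋯ m ℕ.+ N ] (λ i → q^ (+ m +ᶻ + N -ᶻ + i -ᶻ + column μ i)
                                          * hit k m n (removeRow (m ℕ.+ N ℕ.+ 1 ∸ i) μ))
      ≈ scale m N s * expand N (λ i → A i * weight m i) k
    left k = begin
      _ ≈⟨ *-congˡ (row-reindex m N μ (hit k m n) board) ⟩
      _ ≈⟨ *-congˡ (hit-sum [ 1 ⋯ N ] (λ r → removeRow r μ) (λ r → + r -ᶻ 1ℤ) (λ r → + r -ᶻ 1ℤ +ᶻ + part μ r)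
                            s m n k exponent) ⟩
      [ + m -ᶻ + N +ᶻ 1ℤ ]q * (scale m n s * expand N (λ i → A i * weight m i) k)
        ≈⟨ *-assoc _ _ _ ⟨
      [ + m -ᶻ + N +ᶻ 1ℤ ]q * scale m n s * expand N (λ i → A i * weight m i) k
        ≈⟨ *-congʳ (scale-step {m} {n} s m∸n≡ difference) ⟩
      scale m N s * expand N (λ i → A i * weight m i) k ∎

    right : ∀ k → hit k m N μ * q^ (+ k) * [ + N -ᶻ + k ]q + hit (k ℕ.+ 1) m N μ * [ + k +ᶻ 1ℤ ]q
      ≈ scale m N s * expand N (λ i → B i * weight m i) k
    right k = begin
      hit k m N μ * q ^ k * [ + N -ᶻ + k ]q + hit (k ℕ.+ 1) m N μ * [ + (k ℕ.+ 1) ]q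
        ≡⟨ cong (λ j → hit k m N μ * q ^ k * [ + N -ᶻ + k ]q + hit j m N μ * [ + j ]q) (ℕₚ.+-comm k 1) ⟩
      hit k m N μ * q ^ k * [ + N -ᶻ + k ]q + hit (suc k) m N μ * [ + suc k ]q
        ≈⟨ +-cong (*-congʳ (*-congʳ (hit-expand m N μ k))) (*-congʳ (hit-expand m N μ (suc k))) ⟩
      scale m N s * expand (suc N) a k * q ^ k * [ + N -ᶻ + k ]q
        + scale m N s * expand (suc N) a (suc k) * [ + suc k ]q
        ≈⟨ solve 6 (λ s e t b e′ b′ → s :* e :* t :* b :+ s :* e′ :* b′
                     := s :* (e :* (t :* b) :+ e′ :* b′)) refl _ _ _ _ _ _ ⟩
      scale m N s * (expand (suc N) a k * (q ^ k * [ + N -ᶻ + k ]q)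
                     + expand (suc N) a (suc k) * [ + suc k ]q)
        ≈⟨ *-congˡ (row-expand N a k) ⟩
      scale m N s * expand N (λ i → ([ + N ]q - [ + i ]q) * (rook i μ * weight m i)) k
        ≈⟨ *-congˡ (expand-cong N k (λ i _ → *-assoc _ _ _)) ⟨
      scale m N s * expand N (λ i → B i * weight m i) k ∎
      where
      a : ℕ → Carrier
      a i = rook i μ * weight m i

    open Equivalence (expand⇔ N (λ _ → scale m N s) (weight m)
      (λ _ → unit-scale m N s) (unit-weight m) (λ k _ → left k) (λ k _ → right k))
      using (to; from)

    -- The q-rook identity with k the number N of rows, to which no q-hit identity
    -- corresponds: the boards on the left have only N - 1 rows, and the factor on
    -- the right is [N] - [N].
    top : A N ≈ B N
    top = begin
      A N  ≈⟨ ∑-zero [ 1 ⋯ N ] (λ r∈ → trans (*-congˡ (vanishes r∈)) (zeroʳ _)) ⟩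
      0#   ≈⟨ solve 2 (λ b x → con 0ℤ := (b :- b) :* x) refl _ _ ⟩
      B N  ∎
      where
      vanishes : ∀ {r} → r ∈ [ 1 ⋯ N ] → rook N (removeRow r μ) ≈ 0#
      vanishes {r} r∈ = rook-zero N (removeRow r μ) (ℕₚ.≤-reflexive (≡.trans
        (length-removeRow r μ (proj₁ (in-rows r∈)) (proj₂ (in-rows r∈))) rows))

    all-k : (∀ k → k < N → A k ≈ B k) → ∀ k → k < N ⊎ k ≡ N → A k ≈ B k
    all-k h k (inj₁ k<N)    = h k k<N
    all-k h k (inj₂ ≡.refl) = top

  -- Cells

  -- The coefficient of x^k in the q-derivative of (x;q)_{i+1}, which is
  -- -[i+1] (qx;q)_i.
  cell-poch : (i k : ℕ) → [ + suc k ]q * poch (suc i) (suc k) ≈ - (q ^ k * [ + suc i ]q * poch i k)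
  cell-poch i k = begin
    (1# - q ^ suc k) * ι * poch (suc i) (suc k)
      ≈⟨ solve 3 (λ u ι x → u :* ι :* x := ι :* (u :* x)) refl _ _ _ ⟩
    ι * ((1# - q ^ suc k) * poch (suc i) (suc k))
      ≈⟨ *-congˡ (poch-next-both i k) ⟩
    ι * (q ^ k * (q ^ suc i - 1#) * poch i k)
      ≈⟨ solve 4 (λ ι t s x → ι :* (t :* (s :- :1) :* x) := :- (t :* ((:1 :- s) :* ι) :* x)) refl ι (q ^ k) (q ^ suc i) (poch i k) ⟩
    - (q ^ k * ((1# - q ^ suc i) * ι) * poch i k) ∎
    where
    ι : Carrier
    ι = inverse (1# - q) 1-q#0

  -- The q-derivative of the generating polynomial; the constant (x;q)_0 disappears
  -- and the remaining indices drop by one.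
  cell-expand : (m n : ℕ) (ρ : ℕ → Carrier) (k : ℕ) →
    [ + suc k ]q * expand (suc n) (λ i → ρ i * weight (suc m) i) (suc k)
      ≈ q ^ k * q ^ suc m * expand n (λ i → [ + suc i ]q * ρ (suc i) * weight m i) k
  cell-expand m n ρ k = begin
    [ + suc k ]q * expand (suc n) a (suc k)
      ≡⟨ cong ([ + suc k ]q *_) (∑-first n _) ⟩
    [ + suc k ]q * (a 0 * 0# + ∑ (upTo n) (λ i → a (suc i) * poch (suc i) (suc k)))
      ≈⟨ *-congˡ (trans (+-congʳ (zeroʳ _)) (+-identityˡ _)) ⟩
    [ + suc k ]q * ∑ (upTo n) (λ i → a (suc i) * poch (suc i) (suc k))
      ≈⟨ ∑-*ˡ _ (upTo n) _ ⟩
    ∑ (upTo n) (λ i → [ + suc k ]q * (a (suc i) * poch (suc i) (suc k)))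
      ≈⟨ ∑-cong (upTo n) (λ {i} _ → term i) ⟩
    ∑ (upTo n) (λ i → q ^ k * q ^ suc m * ([ + suc i ]q * ρ (suc i) * weight m i * poch i k))
      ≈⟨ ∑-*ˡ _ (upTo n) _ ⟨
    _ ∎
    where
    a : ℕ → Carrier
    a i = ρ i * weight (suc m) i
    term : ∀ i → [ + suc k ]q * (a (suc i) * poch (suc i) (suc k))
      ≈ q ^ k * q ^ suc m * ([ + suc i ]q * ρ (suc i) * weight m i * poch i k)
    term i = begin
      [ + suc k ]q * (a (suc i) * poch (suc i) (suc k))
        ≈⟨ solve 4 (λ b p w x → b :* (p :* w :* x) := p :* w :* (b :* x)) refl _ _ _ _ ⟩
      ρ (suc i) * weight (suc m) (suc i) * ([ + suc k ]q * poch (suc i) (suc k))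
        ≈⟨ *-cong (*-congˡ (weight-suc m i)) (cell-poch i k) ⟩
      ρ (suc i) * - (q ^ suc m * weight m i) * - (q ^ k * [ + suc i ]q * poch i k)
        ≈⟨ solve 6 (λ p s w t b x → p :* :- (s :* w) :* :- (t :* b :* x)
                     := t :* s :* (b :* p :* w :* x)) refl _ _ _ _ _ _ ⟩
      q ^ k * q ^ suc m * ([ + suc i ]q * ρ (suc i) * weight m i * poch i k) ∎

  cell⇔ : (m n : ℕ) (μ : List ℕ) →
    Identities.HitCell (suc m) (suc n) μ ⇔ Identities.RookCell (suc m) (suc n) μ
  cell⇔ m n μ = expand⇔ (suc n) (λ k → q ^ k * scale m n s) (weight m)
    (λ k → unit-* (unit-q^ (+ k)) (unit-scale m n s)) (unit-weight m)
    (λ k _ → trans (*-congˡ (hit-sum (cells μ) (λ c → removeCell c μ)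
        (λ c → + proj₁ c +ᶻ (+ suc m -ᶻ + proj₂ c -ᶻ + column μ (proj₂ c)))
        (λ c → + proj₁ c -ᶻ + proj₂ c +ᶻ + part μ (proj₁ c)) s m n k exponent))
      (sym (*-assoc _ _ _)))
    (λ k _ → right k)
    where
    s : ℤ
    s = + m -ᶻ + size μ

    exponent : ∀ {c} → c ∈ cells μ →
      + proj₁ c +ᶻ (+ suc m -ᶻ + proj₂ c -ᶻ + column μ (proj₂ c)) -ᶻ + size (removeCell c μ)
        ≡ s +ᶻ (+ proj₁ c -ᶻ + proj₂ c +ᶻ + part μ (proj₁ c))
    exponent {i , j} c∈ = ≡.trans
      (before (+ i) (+ m) (+ j) (+ column μ j) (+ part μ i) (+ size (removeCell (i , j) μ)))
      (≡.trans (cong (λ z → + m +ᶻ 1ℤ -ᶻ + z +ᶻ (+ i -ᶻ + j +ᶻ + part μ i)) (size-removeCell μ c∈))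
               (after (+ m) (+ size μ) (+ i -ᶻ + j +ᶻ + part μ i)))
      where
      before : ∀ i m j a b c →
        i +ᶻ (1ℤ +ᶻ m -ᶻ j -ᶻ a) -ᶻ c ≡ m +ᶻ 1ℤ -ᶻ (c +ᶻ a +ᶻ b) +ᶻ (i -ᶻ j +ᶻ b)
      before = ℤ-Solver.solve-∀
      after : ∀ m z f → m +ᶻ 1ℤ -ᶻ (1ℤ +ᶻ z) +ᶻ f ≡ m -ᶻ z +ᶻ f
      after = ℤ-Solver.solve-∀

    right : ∀ k → [ + k +ᶻ 1ℤ ]q * hit (k ℕ.+ 1) (suc m) (suc n) μ
      ≈ q ^ k * scale m n s
        * expand (suc n) (λ i → q * [ + i +ᶻ 1ℤ ]q * rook (i ℕ.+ 1) μ * weight m i) k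
    right k = begin
      [ + (k ℕ.+ 1) ]q * hit (k ℕ.+ 1) (suc m) (suc n) μ
        ≡⟨ cong (λ j → [ + j ]q * hit j (suc m) (suc n) μ) (ℕₚ.+-comm k 1) ⟩
      [ + suc k ]q * hit (suc k) (suc m) (suc n) μ
        ≈⟨ *-congˡ (hit-expand (suc m) (suc n) μ (suc k)) ⟩
      [ + suc k ]q * (S * expand (suc (suc n)) (λ i → rook i μ * weight (suc m) i) (suc k))
        ≈⟨ solve 3 (λ x y z → x :* (y :* z) := y :* (x :* z)) refl _ _ _ ⟩
      S * ([ + suc k ]q * expand (suc (suc n)) (λ i → rook i μ * weight (suc m) i) (suc k))
        ≈⟨ *-congˡ (cell-expand m (suc n) (λ i → rook i μ) k) ⟩
      S * (q ^ k * q ^ suc m * expand (suc n) T k)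
        ≈⟨ solve 5 (λ S t q s E → S :* (t :* (q :* s) :* E) := t :* (s :* S) :* (q :* E)) refl _ _ _ _ _ ⟩
      q ^ k * (q ^ m * S) * (q * expand (suc n) T k)
        ≈⟨ *-cong (*-congˡ (sym (scale-+ m n (+ m) (-ᶻ (+ size μ))))) (∑-*ˡ q (upTo (suc n)) _) ⟩
      q ^ k * scale m n s * ∑ (upTo (suc n)) (λ i → q * (T i * poch i k))
        ≈⟨ *-congˡ (∑-cong (upTo (suc n)) (λ {i} _ → term i)) ⟩
      _ ∎
      where
      S : Carrier
      S = scale m n (-ᶻ (+ size μ))
      T : ℕ → Carrier
      T i = [ + suc i ]q * rook (suc i) μ * weight m i
      term : ∀ i → q * (T i * poch i k)
        ≈ q * [ + i +ᶻ 1ℤ ]q * rook (i ℕ.+ 1) μ * weight m i * poch i k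
      term i = begin
        q * (T i * poch i k)
          ≈⟨ solve 5 (λ q b p w x → q :* (b :* p :* w :* x) := q :* b :* p :* w :* x) refl _ _ _ _ _ ⟩
        q * [ + suc i ]q * rook (suc i) μ * weight m i * poch i k
          ≡⟨ cong (λ j → q * [ + j ]q * rook j μ * weight m i * poch i k) (ℕₚ.+-comm i 1) ⟨
        q * [ + (i ℕ.+ 1) ]q * rook (i ℕ.+ 1) μ * weight m i * poch i k ∎

lemma3p4 : ∀ {c ℓ₁ ℓ₂} (K : HeytingField c ℓ₁ ℓ₂)
    (q : HeytingField.Carrier K) (q-ind : Indeterminacy.Indeterminate K q)
    (m n : ℕ) → n ≤ m → (μ : List ℕ) → InBoard n m μ →
    let open QRook.Identities K q q-ind m n μ in
    (n < m → HitColumn ⇔ RookColumn)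
    × (1 ≤ n → HitRow ⇔ RookRow)
    × (1 ≤ n → HitCell ⇔ RookCell)
lemma3p4 K q q-ind m n n≤m μ board = columns , rows n n≤m board , cells′ m n n≤m
  where
  open QRook K q q-ind using (module Identities)
  open HitRook K q q-ind
  columns : n < m → Identities.HitColumn m n μ ⇔ Identities.RookColumn m n μ
  columns (s≤s n≤m′) = column⇔ _ n μ board n≤m′
  rows : ∀ n → n ≤ m → InBoard n m μ → 1 ≤ n → Identities.HitRow m n μ ⇔ Identities.RookRow m n μ
  rows (suc n) n<m board _ = row⇔ m n μ board n<m
  cells′ : ∀ m n → n ≤ m → 1 ≤ n → Identities.HitCell m n μ ⇔ Identities.RookCell m n μ
  cells′ (suc m) (suc n) _ _ = cell⇔ m n μ
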